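{- For every $d\ge2$, the number of similarity classes of $d$-dimensional perfect lattices is at most $$I_d^{\,d+1}\binom{3^dI_d}{\binom d2}.$$
   Context: A $d$-dimensional Euclidean lattice $\Lambda$ is perfect if $\{v\otimes v\}$, $v$ ranging over its minimal vectors (nonzero vectors of minimal length), spans the $\binom{d+1}{2}$-dimensional space of symmetric tensors in $(\Lambda\otimes\mathbb R)^{\otimes2}$. A lattice is well-rounded if its minimal vectors span $\Lambda\otimes\mathbb R$. $I_d$ is the smallest integer such that whenever $\Lambda$ is a $d$-dimensional lattice and $\Lambda'\subseteq\Lambda$ is a $d$-dimensional well-rounded sublattice whose minimal vectors are all minimal vectors of $\Lambda$, the index $[\Lambda:\Lambda']$ is at most $I_d$. -}

module Defs where

open import Algebra.Bundles using (CommutativeRing)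
open import Data.Fin.Base using (Fin)
open import Data.Integer.Base as ℤ using (ℤ)
open import Data.Nat.Base as ℕ using (ℕ; suc)
open import Data.Product.Base using (Σ-syntax; ∃-syntax; _×_; _,_)
open import Data.Vec.Functional using (Vector)
open import Level using (0ℓ)
open import Relation.Binary.Core using (Rel)
open import Relation.Binary.PropositionalEquality.Core using (_≡_)
open import Relation.Binary.Structures using (IsDecTotalOrder)
open import Relation.Nullary.Negation using (¬_)
open import Relation.Unary using (Pred)
import Algebra.Properties.Monoid.Mult as Mult
import Algebra.Properties.Monoid.Sum as Sum

-- The real numbers, axiomatised: classically, a Dedekind-complete ordered
-- field is unique up to unique isomorphism.  The order is assumed decidable,
-- as it is for ℝ in classical mathematics.
record CompleteOrderedField : Set₁ where
  infix 4 _≤_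
  field
    commutativeRing : CommutativeRing 0ℓ 0ℓ

  open CommutativeRing commutativeRing public

  field
    0≉1             : ¬ (0# ≈ 1#)
    inverse         : ∀ x → ¬ (x ≈ 0#) → ∃[ y ] x * y ≈ 1#
    _≤_             : Rel Carrier 0ℓ
    isDecTotalOrder : IsDecTotalOrder _≈_ _≤_
    +-monoʳ-≤       : ∀ z {x y} → x ≤ y → (z + x) ≤ (z + y)
    *-nonNegative   : ∀ {x y} → 0# ≤ x → 0# ≤ y → 0# ≤ (x * y)

  IsUpperBound : Pred Carrier 0ℓ → Pred Carrier 0ℓ
  IsUpperBound S b = ∀ x → S x → x ≤ b

  field
    complete : (S : Pred Carrier 0ℓ) → ∃[ x ] S x → ∃[ b ] IsUpperBound S b →
               ∃[ s ] (IsUpperBound S s × (∀ b → IsUpperBound S b → s ≤ b))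

-- The number of ∼-classes of elements of A satisfying P is at most n:
-- a family of pairwise inequivalent such elements has at most n members.
ClassesAtMost : {A : Set} → Pred A 0ℓ → Rel A 0ℓ → ℕ → Set
ClassesAtMost {A} P _∼_ n =
  ∀ m (f : Fin m → A) → (∀ i → P (f i)) →
  (∀ i j → f i ∼ f j → i ≡ j) → m ℕ.≤ n

module EuclideanLattices (ℝ : CompleteOrderedField) where

  open CompleteOrderedField ℝ
  open Sum +-monoid using (sum)
  open Mult +-monoid using () renaming (_×_ to _×ℕ_)

  private
    R = Carrier

  fromℤ : ℤ → R
  fromℤ (ℤ.+ n)    = n ×ℕ 1#
  fromℤ ℤ.-[1+ n ] = - (suc n ×ℕ 1#)

  -- Real families indexed by a type X, with pointwise equality; X = Fin d
  -- gives ℝᵈ and X = Fin d × Fin d gives ℝᵈ ⊗ ℝᵈ.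
  infix 4 _≋_
  _≋_ : {X : Set} → Rel (X → R) 0ℓ
  x ≋ y = ∀ i → x i ≈ y i

  combination : {X : Set} {n : ℕ} → Vector R n → Vector (X → R) n → (X → R)
  combination c w t = sum (λ k → c k * w k t)

  Span : {X : Set} → Pred (X → R) 0ℓ → Pred (X → R) 0ℓ
  Span P x = ∃[ n ] ∃[ c ] ∃[ w ]
    ((∀ (k : Fin n) → P (w k)) × x ≋ combination c w)

  module _ {d : ℕ} where

    𝟎 : Vector R d
    𝟎 _ = 0#

    ⟨_,_⟩ : Vector R d → Vector R d → R
    ⟨ x , y ⟩ = sum (λ i → x i * y i)

    Tensor : Set
    Tensor = Fin d × Fin d → R

    _⊗_ : Vector R d → Vector R d → Tensor
    (x ⊗ y) (i , j) = x i * y j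

    Symmetric : Pred Tensor 0ℓ
    Symmetric t = ∀ i j → t (i , j) ≈ t (j , i)

    LinearlyIndependent : {n : ℕ} → Pred (Vector (Vector R d) n) 0ℓ
    LinearlyIndependent b = ∀ c → combination c b ≋ 𝟎 → ∀ i → c i ≈ 0#

  -- A d-dimensional lattice, presented inside Λ ⊗ ℝ = ℝᵈ with its standard
  -- inner product by a basis.  All notions below depend only on the set of
  -- lattice vectors, not on the chosen basis.
  record Lattice (d : ℕ) : Set where
    field
      basis       : Vector (Vector R d) d
      independent : LinearlyIndependent basis

  module _ {d : ℕ} where

    infix 4 _∈_ _⊆_
    _∈_ : Vector R d → Lattice d → Set
    v ∈ Λ = Σ[ c ∈ Vector ℤ d ]
      v ≋ combination (λ i → fromℤ (c i)) (Lattice.basis Λ)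

    _⊆_ : Rel (Lattice d) 0ℓ
    Λ′ ⊆ Λ = ∀ v → v ∈ Λ′ → v ∈ Λ

    -- Lengths are compared through their squares.
    Minimal : Lattice d → Pred (Vector R d) 0ℓ
    Minimal Λ v = v ∈ Λ × ¬ (v ≋ 𝟎) ×
      (∀ w → w ∈ Λ → ¬ (w ≋ 𝟎) → ⟨ v , v ⟩ ≤ ⟨ w , w ⟩)

    WellRounded : Pred (Lattice d) 0ℓ
    WellRounded Λ = (x : Vector R d) → Span (Minimal Λ) x

    Perfect : Pred (Lattice d) 0ℓ
    Perfect Λ = (t : Tensor {d}) → Symmetric t →
      Span (λ s → ∃[ v ] (Minimal Λ v × s ≋ v ⊗ v)) t

    -- A linear similarity of ℝᵈ, of ratio √scale, mapping Λ onto Λ′.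
    record Similar (Λ Λ′ : Lattice d) : Set where
      field
        map          : Vector R d → Vector R d
        map-cong     : ∀ x y → x ≋ y → map x ≋ map y
        map-additive : ∀ x y → map (λ i → x i + y i) ≋ (λ i → map x i + map y i)
        map-scalar   : ∀ a x → map (λ i → a * x i) ≋ (λ i → a * map x i)
        scale        : R
        0≤scale      : 0# ≤ scale
        scale≉0      : ¬ (scale ≈ 0#)
        map-inner    : ∀ x y → ⟨ map x , map y ⟩ ≈ scale * ⟨ x , y ⟩
        into         : ∀ v → v ∈ Λ → map v ∈ Λ′
        onto         : ∀ w → w ∈ Λ′ → ∃[ v ] (v ∈ Λ × map v ≋ w)

    -- [Λ : Λ′] ≤ n, the index being the number of cosets of Λ′ in Λ.
    IndexAtMost : Lattice d → Lattice d → ℕ → Set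
    IndexAtMost Λ Λ′ n = ClassesAtMost (_∈ Λ) (λ x y → (λ i → x i - y i) ∈ Λ′) n

  BoundsIndices : (d : ℕ) → Pred ℕ 0ℓ
  BoundsIndices d n = (Λ Λ′ : Lattice d) → Λ′ ⊆ Λ → WellRounded Λ′ →
    (∀ v → Minimal Λ′ v → Minimal Λ v) → IndexAtMost Λ Λ′ n

  -- I is the number I_d.
  IsMaximalIndex : (d : ℕ) → Pred ℕ 0ℓ
  IsMaximalIndex d I =
    BoundsIndices d I × (∀ n → BoundsIndices d n → I ℕ.≤ n)

{-# OPTIONS --safe #-}

-- Fix a perfect lattice Λ.  Among the bases of ℝᵈ consisting of minimal vectors
-- of Λ take one, b, spanning a sublattice of maximal index; the index is at most
-- I, since this sublattice is well-rounded with minimal vectors minimal in Λ.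
-- By maximality all minimal vectors of Λ have coordinates in [-1, 1] in b.  The
-- Hermite normal form A of b in a suitable basis of Λ has determinant the index,
-- and row i of A, diagonal included, is encoded by a number below the product of
-- the diagonal entries from i on, hence below I.  A minimal vector is determined
-- by its residue modulo b (at most I values) and the floors of its coordinates
-- (3ᵈ values).  Normalising the minimum to 1 fixes the diagonal of the Gram
-- matrix of b; as Λ is perfect, the d(d-1)/2 off-diagonal entries are determined
-- by the equations ⟨v , v⟩ = 1 for d(d-1)/2 suitable minimal vectors v.  So A and
-- the set of codes of these v determine Λ up to similarity.
--
-- The conclusion is an inequality of natural numbers, hence stable under double
-- negation, so the choices above need only be made up to double negation.

module Submission where

open import Defs
open import Algebra.Solver.Ring.AlmostCommutativeRing
  using (fromCommutativeRing; _-Raw-AlmostCommutative⟶_)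
open import Data.Fin using
  (Fin; zero; suc; toℕ; fromℕ; fromℕ<; splitAt; _↑ˡ_; _↑ʳ_; punchIn; punchOut;
   inject≤; combine; remQuot; funToFin; finToFun)
open import Data.Fin.Permutation.Components using (transpose; transpose-inverse)
open import Data.Integer as ℤ using (ℤ; -[1+_])
open import Data.Integer.DivMod using (_/ℕ_; _%ℕ_; n%ℕd<d; a≡a%ℕn+[a/ℕn]*n)
open import Data.Maybe using () renaming (map to mapMaybe)
open import Data.Nat as ℕ using (ℕ; zero; suc)
open import Data.Nat.Combinatorics using (_C_; nCk+nC[k+1]≡[n+1]C[k+1]; nC1≡n)
open import Data.Product using (Σ-syntax; ∃-syntax; _×_; _,_; proj₁; proj₂)
open import Data.Sum using (inj₁; inj₂; [_,_]′)
open import Data.Vec using (Vec; []; _∷_; lookup; _[_]≔_)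
open import Data.Vec.Functional using (Vector; tail; _++_)
open import Function.Base using (_∘_)
open import Function.Definitions using (Injective)
open import Level using (0ℓ)
open import Relation.Binary.PropositionalEquality as ≡ using (_≡_; _≢_; cong)
open import Relation.Binary.Structures using (IsDecTotalOrder)
open import Relation.Nullary using (¬_; Dec; yes; no; contradiction)
open import Relation.Nullary.Decidable using (decidable-stable; dec⇒maybe)
open import Relation.Unary using (Pred)
import Algebra.Properties.CommutativeMonoid.Sum as CommutativeMonoidSum
import Algebra.Properties.Ring as RingProperties
import Algebra.Properties.Semiring.Mult as SemiringMult
import Algebra.Properties.Semiring.Sum as SemiringSum
import Algebra.Solver.Ring as RingSolver
import Data.Fin.Permutation as Permutation
import Data.Fin.Properties as Finₚ
import Data.Integer.DivMod as ℤDivMod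
import Data.Integer.Properties as ℤₚ
import Data.Nat.Properties as ℕₚ
import Data.Vec.Functional as V
import Data.Vec.Properties as Vecₚ
import Relation.Binary.Reasoning.Setoid as SetoidReasoning

-- The index of a frame is never a number here: families of pairwise incongruent lattice vectors
-- bound it from below, which is how the definition of `I` speaks of it, and only for triangular
-- matrices is it computed, as `det`. This shapes the exchange step. Putting a minimal vector v in
-- place of b_a multiplies the index by |ξ_a|, where ξ_a is the coordinate of v at b_a. To see the
-- growth without general determinants, a is moved to the last place: there, in the Hermite basis of
-- b, only the last column of A changes, and its last entry is multiplied by ξ_a. Applied to v and
-- -v, maximality gives |ξ_a| ≤ 1. Spanning is used in dual form: only the zero vector is orthogonal
-- to the set. Exchange within a pair of dual bases then extracts a basis from the set. This happens
-- twice, for the minimal vectors in ℝᵈ and for the vectors of products ξ_a ξ_c with a < c, which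
-- are the coefficients of the equations for the off-diagonal Gram entries. Codes of vectors refer
-- to coordinates in b and never to ℝᵈ itself, so that they can be compared between different
-- lattices.

-- Choices up to double negation.

¬¬-Fin : ∀ m {P : Fin m → Set} → (∀ i → ¬ ¬ P i) → ¬ ¬ (∀ i → P i)
¬¬-Fin zero    h k = k λ ()
¬¬-Fin (suc m) h k = h zero λ p → ¬¬-Fin m (h ∘ suc) λ ps →
  k λ { zero → p ; (suc i) → ps i }

-- If no `k` were the last one of a run, `P` would climb from 0, up to double negation, past the
-- bound `n`. No decidability of `P` enters.
¬¬-maximum : {P : ℕ → Set} {n : ℕ} → P 0 → (∀ k → P k → k ℕ.≤ n) →
             ¬ ¬ (∃[ k ] (P k × ¬ P (suc k)))
¬¬-maximum {P} {n} p₀ bounded none = climb (suc n) λ p →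
  ℕₚ.<-irrefl ≡.refl (bounded (suc n) p)
  where
  climb : ∀ k → ¬ ¬ P k
  climb zero    ¬p = ¬p p₀
  climb (suc k) ¬p = climb k λ p → none (k , p , ¬p)

-- Binomial coefficients and subsets of a finite set.

-- Defined by Pascal's recursion so that `Fin (pascal n k)` computes to a sum of two blocks, as
-- `rank` requires; only the final bound is restated with `_C_`.
pascal : ℕ → ℕ → ℕ
pascal n       zero    = 1
pascal zero    (suc k) = 0
pascal (suc n) (suc k) = pascal n k ℕ.+ pascal n (suc k)

pascal≡C : ∀ n k → pascal n k ≡ n C k
pascal≡C n       zero    = ≡.refl
pascal≡C zero    (suc k) = ≡.refl
pascal≡C (suc n) (suc k) = ≡.trans
  (≡.cong₂ ℕ._+_ (pascal≡C n k) (pascal≡C n (suc k)))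
  (nCk+nC[k+1]≡[n+1]C[k+1] n k)

-- The number of entries strictly above the diagonal of a matrix of size d, counted by rows: the
-- recursion is that of `upper`.
triangle : ℕ → ℕ
triangle zero    = 0
triangle (suc d) = d ℕ.+ triangle d

triangle≡C2 : ∀ d → triangle d ≡ d C 2
triangle≡C2 zero    = ≡.refl
triangle≡C2 (suc d) = ≡.trans
  (≡.cong₂ ℕ._+_ (≡.sym (nC1≡n d)) (triangle≡C2 d))
  (nCk+nC[k+1]≡[n+1]C[k+1] d 1)

-- Subsets with `k` elements of a set with `n` elements, as words. Each subset has exactly one word,
-- so propositional equality is equality of subsets.
data Combination : ℕ → ℕ → Set where
  []   : Combination 0 0
  take : ∀ {n k} → Combination n k → Combination (suc n) (suc k)
  skip : ∀ {n k} → Combination n k → Combination (suc n) k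

data _∈ᶜ_ : ∀ {n k} → Fin n → Combination n k → Set where
  here : ∀ {n k} {s : Combination n k} → zero ∈ᶜ take s
  took : ∀ {n k} {i : Fin n} {s : Combination n k} → i ∈ᶜ s → suc i ∈ᶜ take s
  skip : ∀ {n k} {i : Fin n} {s : Combination n k} → i ∈ᶜ s → suc i ∈ᶜ skip s

rank : ∀ {n k} → Combination n k → Fin (pascal n k)
rank []                         = zero
rank (take s)                   = rank s ↑ˡ _
rank {suc n} {zero}    (skip s) = zero
rank {suc n} {k@(suc l)} (skip s) = pascal n l ↑ʳ rank s

empty-unique : ∀ {n} (s t : Combination n 0) → s ≡ t
empty-unique []       []       = ≡.refl
empty-unique (skip s) (skip t) = cong skip (empty-unique s t)

↑ˡ≢↑ʳ : ∀ {m n} (i : Fin m) (j : Fin n) → i ↑ˡ n ≢ m ↑ʳ j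
↑ˡ≢↑ʳ {suc m} zero    j ()
↑ˡ≢↑ʳ {suc m} (suc i) j eq = ↑ˡ≢↑ʳ i j (Finₚ.suc-injective eq)

rank-injective : ∀ {n k} (s t : Combination n k) → rank s ≡ rank t → s ≡ t
rank-injective {k = zero}      s        t        eq = empty-unique s t
rank-injective {suc n} {suc k} (take s) (take t) eq =
  cong take (rank-injective s t (Finₚ.↑ˡ-injective (pascal n (suc k)) _ _ eq))
rank-injective {suc n} {suc k} (take s) (skip t) eq =
  contradiction eq (↑ˡ≢↑ʳ (rank s) (rank t))
rank-injective {suc n} {suc k} (skip s) (take t) eq =
  contradiction (≡.sym eq) (↑ˡ≢↑ʳ (rank t) (rank s))
rank-injective {suc n} {suc k} (skip s) (skip t) eq =
  cong skip (rank-injective s t (Finₚ.↑ʳ-injective (pascal n k) _ _ eq))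

suc-punchOut : ∀ {n} {i : Fin (suc n)} (0≢i : zero ≢ i) → suc (punchOut 0≢i) ≡ i
suc-punchOut {i = zero}  0≢i = contradiction ≡.refl 0≢i
suc-punchOut {i = suc i} 0≢i = ≡.refl

Image : ∀ {n k} → (Fin k → Fin n) → Combination n k → Set
Image f s = (∀ i → f i ∈ᶜ s) × (∀ x → x ∈ᶜ s → ∃[ i ] f i ≡ x)

-- Recursion on the codomain: an injective `f` takes the value `zero` at most once. Either it does
-- not, or its one preimage `p` is deleted from the domain; the other values are shifted down.
image : ∀ {n k} (f : Fin k → Fin n) → Injective _≡_ _≡_ f →
        Σ[ s ∈ Combination n k ] Image f s
image {zero}  {zero}  f inj = [] , (λ ()) , λ x ()
image {zero}  {suc k} f inj with () ← f zero
image {suc n} {k}     f inj with Finₚ.any? (λ i → zero Finₚ.≟ f i)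
image {suc n} {k}     f inj | no 0∉f = skip s , into , onto
  where
  0≢f : ∀ i → zero ≢ f i
  0≢f i eq = 0∉f (i , eq)
  g : Fin k → Fin n
  g i = punchOut (0≢f i)
  ih = image g λ {i} {j} eq → inj (Finₚ.punchOut-injective (0≢f i) (0≢f j) eq)
  s = proj₁ ih
  into : ∀ i → f i ∈ᶜ skip s
  into i = ≡.subst (_∈ᶜ skip s) (suc-punchOut (0≢f i)) (skip (proj₁ (proj₂ ih) i))
  onto : ∀ x → x ∈ᶜ skip s → ∃[ i ] f i ≡ x
  onto (suc x) (skip x∈s) with i , eq ← proj₂ (proj₂ ih) x x∈s =
    i , ≡.trans (≡.sym (suc-punchOut (0≢f i))) (cong suc eq)
image {suc n} {suc k} f inj | yes (p , 0≡fp) = take s , into , onto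
  where
  0≢f : ∀ i → zero ≢ f (punchIn p i)
  0≢f i eq = Finₚ.punchInᵢ≢i p i (inj (≡.trans (≡.sym eq) 0≡fp))
  g : Fin k → Fin n
  g i = punchOut (0≢f i)
  ih = image g λ {i} {j} eq → Finₚ.punchIn-injective p i j
    (inj (Finₚ.punchOut-injective (0≢f i) (0≢f j) eq))
  s = proj₁ ih
  into : ∀ i → f i ∈ᶜ take s
  into i with p Finₚ.≟ i
  ... | yes ≡.refl = ≡.subst (_∈ᶜ take s) 0≡fp here
  ... | no  p≢i  = ≡.subst (_∈ᶜ take s)
    (≡.trans (suc-punchOut (0≢f (punchOut p≢i))) (cong f (Finₚ.punchIn-punchOut p≢i)))
    (took (proj₁ (proj₂ ih) (punchOut p≢i)))
  onto : ∀ x → x ∈ᶜ take s → ∃[ i ] f i ≡ x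
  onto zero    here       = p , ≡.sym 0≡fp
  onto (suc x) (took x∈s) with i , eq ← proj₂ (proj₂ ih) x x∈s =
    punchIn p i , ≡.trans (≡.sym (suc-punchOut (0≢f i))) (cong suc eq)

-- Arithmetic of the ordered field, its integers, finite sums.

module FieldProperties (ℝ : CompleteOrderedField) where

  open CompleteOrderedField ℝ public hiding (zero; complete)
  open IsDecTotalOrder isDecTotalOrder public
    using (_≟_; _≤?_; total; antisym)
    renaming (refl to ≤-refl; trans to ≤-trans; reflexive to ≤-reflexive; ≤-respˡ-≈ to ≤-respˡ; ≤-respʳ-≈ to ≤-respʳ)
  open EuclideanLattices ℝ public
  open RingProperties ring public using (-‿distribˡ-*; -‿distribʳ-*; -0#≈0#; -‿involutive; -‿+-comm)
  open SemiringMult semiring using (×-homo-+) renaming (_×_ to _×ℕ_)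
  open SemiringSum semiring public using (sum; *-distribˡ-sum; *-distribʳ-sum)
  open CommutativeMonoidSum +-commutativeMonoid public
    using (sum-cong-≋; ∑-distrib-+; ∑-comm; sum-replicate-zero; sum-permute)
  open SetoidReasoning setoid public

  R : Set
  R = Carrier

  ι : ℤ → R
  ι = fromℤ

  ι-⊖ : ∀ m n → ι (m ℤ.⊖ n) ≈ m ×ℕ 1# - n ×ℕ 1#
  ι-⊖ m zero = begin
    m ×ℕ 1#          ≈⟨ +-identityʳ _ ⟨
    m ×ℕ 1# + 0#     ≈⟨ +-congˡ -0#≈0# ⟨
    m ×ℕ 1# - 0#     ∎
  ι-⊖ zero (suc n) = sym (+-identityˡ _)
  ι-⊖ (suc m) (suc n) = begin
    ι (suc m ℤ.⊖ suc n)                       ≡⟨ cong ι (ℤₚ.[1+m]⊖[1+n]≡m⊖n m n) ⟩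
    ι (m ℤ.⊖ n)                               ≈⟨ ι-⊖ m n ⟩
    M - N                                     ≈⟨ +-congʳ (+-identityˡ M) ⟨
    0# + M - N                                ≈⟨ +-congʳ (+-congʳ (-‿inverseʳ 1#)) ⟨
    1# - 1# + M - N                           ≈⟨ +-congʳ (+-assoc _ _ _) ⟩
    1# + (- 1# + M) - N                       ≈⟨ +-congʳ (+-congˡ (+-comm _ _)) ⟩
    1# + (M - 1#) - N                         ≈⟨ +-congʳ (+-assoc _ _ _) ⟨
    1# + M - 1# - N                           ≈⟨ +-assoc _ _ _ ⟩
    1# + M + (- 1# - N)                       ≈⟨ +-congˡ (-‿+-comm 1# N) ⟩
    1# + M - (1# + N)                         ∎
    where
    M = m ×ℕ 1#
    N = n ×ℕ 1#

  ι-neg : ∀ i → ι (ℤ.- i) ≈ - ι i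
  ι-neg (ℤ.+ zero)    = sym -0#≈0#
  ι-neg (ℤ.+ suc n)   = refl
  ι-neg -[1+ n ]      = sym (-‿involutive _)

  ι-+ : ∀ i j → ι (i ℤ.+ j) ≈ ι i + ι j
  ι-+ (ℤ.+ m)  (ℤ.+ n)  = ×-homo-+ 1# m n
  ι-+ (ℤ.+ m)  -[1+ n ] = ι-⊖ m (suc n)
  ι-+ -[1+ m ] (ℤ.+ n)  = trans (ι-⊖ n (suc m)) (+-comm _ _)
  ι-+ -[1+ m ] -[1+ n ] = begin
    - ((2 ℕ.+ (m ℕ.+ n)) ×ℕ 1#)              ≡⟨ cong (λ k → - (suc k ×ℕ 1#)) (ℕₚ.+-suc m n) ⟨
    - ((suc m ℕ.+ suc n) ×ℕ 1#)              ≈⟨ -‿cong (×-homo-+ 1# (suc m) (suc n)) ⟩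
    - (suc m ×ℕ 1# + suc n ×ℕ 1#)            ≈⟨ -‿+-comm _ _ ⟨
    - (suc m ×ℕ 1#) - suc n ×ℕ 1#            ∎

  ι-*⁺ : ∀ m j → ι (ℤ.+ m ℤ.* j) ≈ ι (ℤ.+ m) * ι j
  ι-*⁺ zero    j = begin
    ι (ℤ.0ℤ ℤ.* j)  ≡⟨ cong ι (ℤₚ.*-zeroˡ j) ⟩
    0#              ≈⟨ zeroˡ (ι j) ⟨
    0# * ι j        ∎
  ι-*⁺ (suc m) j = begin
    ι (ℤ.+ suc m ℤ.* j)            ≡⟨ cong ι (ℤₚ.suc-* (ℤ.+ m) j) ⟩
    ι (j ℤ.+ ℤ.+ m ℤ.* j)          ≈⟨ ι-+ j (ℤ.+ m ℤ.* j) ⟩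
    ι j + ι (ℤ.+ m ℤ.* j)          ≈⟨ +-cong (sym (*-identityˡ (ι j))) (ι-*⁺ m j) ⟩
    1# * ι j + ι (ℤ.+ m) * ι j     ≈⟨ distribʳ _ _ _ ⟨
    (1# + ι (ℤ.+ m)) * ι j         ∎

  ι-* : ∀ i j → ι (i ℤ.* j) ≈ ι i * ι j
  ι-* (ℤ.+ m)  j = ι-*⁺ m j
  ι-* -[1+ m ] j = begin
    ι (-[1+ m ] ℤ.* j)                ≡⟨ cong ι (ℤₚ.neg-distribˡ-* (ℤ.+ suc m) j) ⟨
    ι (ℤ.- (ℤ.+ suc m ℤ.* j))         ≈⟨ ι-neg (ℤ.+ suc m ℤ.* j) ⟩
    - ι (ℤ.+ suc m ℤ.* j)             ≈⟨ -‿cong (ι-*⁺ (suc m) j) ⟩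
    - (ι (ℤ.+ suc m) * ι j)           ≈⟨ -‿distribˡ-* _ _ ⟩
    ι -[1+ m ] * ι j                  ∎

  ι-1 : ι (ℤ.+ 1) ≈ 1#
  ι-1 = +-identityʳ 1#

  ι-minus : ∀ i j → ι (i ℤ.- j) ≈ ι i - ι j
  ι-minus i j = trans (ι-+ i (ℤ.- j)) (+-congˡ (ι-neg j))

  -- Gives the ring solver integer coefficients, whose equality is decided by computation.
  ι-morphism : ℤ.+-*-rawRing -Raw-AlmostCommutative⟶ fromCommutativeRing commutativeRing
  ι-morphism = record
    { ⟦_⟧ = ι ; +-homo = ι-+ ; *-homo = ι-* ; -‿homo = ι-neg
    ; 0-homo = refl ; 1-homo = ι-1 }

  open RingSolver ℤ.+-*-rawRing (fromCommutativeRing commutativeRing) ι-morphism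
    (λ i j → mapMaybe (λ eq → reflexive (cong ι eq)) (dec⇒maybe (i ℤ.≟ j))) public
    using (solve; con; _:=_; _:+_; _:*_; _:-_; :-_)

  infix 4 _<_
  -- A negation, since this is the form in which `decidable-stable` applied to `_≤?_` supplies a
  -- strict inequality.
  _<_ : R → R → Set
  x < y = ¬ (y ≤ x)

  <⇒≤ : ∀ {x y} → x < y → x ≤ y
  <⇒≤ {x} {y} x<y with total x y
  ... | inj₁ x≤y = x≤y
  ... | inj₂ y≤x = contradiction y≤x x<y

  x≤y⇒0≤y-x : ∀ {x y} → x ≤ y → 0# ≤ y - x
  x≤y⇒0≤y-x {x} {y} x≤y = ≤-respˡ (-‿inverseˡ x) (≤-respʳ (+-comm (- x) y) (+-monoʳ-≤ (- x) x≤y))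

  0≤y-x⇒x≤y : ∀ {x y} → 0# ≤ y - x → x ≤ y
  0≤y-x⇒x≤y {x} {y} 0≤ = ≤-respˡ (+-identityʳ x)
    (≤-respʳ (solve 2 (λ x y → x :+ (y :- x) := y) refl x y) (+-monoʳ-≤ x 0≤))

  -- Rearranges a linear inequality: two inequalities with the same difference of sides are
  -- equivalent, and the ring solver compares the differences.
  ≤-via : ∀ {a b c d} → d - c ≈ b - a → a ≤ b → c ≤ d
  ≤-via eq a≤b = 0≤y-x⇒x≤y (≤-respʳ (sym eq) (x≤y⇒0≤y-x a≤b))

  +-mono : ∀ {a b c d} → a ≤ b → c ≤ d → a + c ≤ b + d
  +-mono {a} {b} {c} {d} a≤b c≤d = ≤-trans (+-monoʳ-≤ a c≤d)
    (≤-respˡ (+-comm d a) (≤-respʳ (+-comm d b) (+-monoʳ-≤ d a≤b)))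

  neg-antimono : ∀ {x y} → x ≤ y → - y ≤ - x
  neg-antimono {x} {y} = ≤-via (solve 2 (λ x y → :- x :- (:- y) := y :- x) refl x y)

  0≤x² : ∀ x → 0# ≤ x * x
  0≤x² x with total 0# x
  ... | inj₁ 0≤x = *-nonNegative 0≤x 0≤x
  ... | inj₂ x≤0 = ≤-respʳ (solve 1 (λ x → :- x :* (:- x) := x :* x) refl x)
    (*-nonNegative 0≤-x 0≤-x)
    where 0≤-x = ≤-respˡ -0#≈0# (neg-antimono x≤0)

  0≤1 : 0# ≤ 1#
  0≤1 = ≤-respʳ (*-identityˡ 1#) (0≤x² 1#)

  0≤ι⁺ : ∀ n → 0# ≤ ι (ℤ.+ n)
  0≤ι⁺ zero    = ≤-refl
  0≤ι⁺ (suc n) = ≤-respˡ (+-identityʳ 0#) (+-mono 0≤1 (0≤ι⁺ n))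

  ι-mono-0≤ : ∀ {i} → ℤ.0ℤ ℤ.≤ i → 0# ≤ ι i
  ι-mono-0≤ {ℤ.+ n} _ = 0≤ι⁺ n

  ι-mono : ∀ {i j} → i ℤ.≤ j → ι i ≤ ι j
  ι-mono {i} {j} i≤j = 0≤y-x⇒x≤y (≤-respʳ (ι-minus j i) (ι-mono-0≤ (ℤₚ.i≤j⇒0≤j-i i≤j)))

  ι-cancel-< : ∀ {i j} → ι i < ι j → i ℤ.< j
  ι-cancel-< ιi<ιj = ℤₚ.≰⇒> (ιi<ιj ∘ ι-mono)

  0<1 : 0# < 1#
  0<1 1≤0 = 0≉1 (antisym 0≤1 1≤0)

  0<1+n : ∀ n → 0# < ι (ℤ.+ suc n)
  0<1+n n ≤0 = 0<1 (≤-trans (≤-respˡ (+-identityʳ 1#) (+-monoʳ-≤ 1# (0≤ι⁺ n))) ≤0)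

  ι≉0 : ∀ n → ¬ (ι (ℤ.+ suc n) ≈ 0#)
  ι≉0 n eq = 0<1+n n (≤-reflexive eq)

  ι-injective-0 : ∀ i → ι i ≈ 0# → i ≡ ℤ.0ℤ
  ι-injective-0 (ℤ.+ zero)  eq = ≡.refl
  ι-injective-0 (ℤ.+ suc n) eq = contradiction eq (ι≉0 n)
  ι-injective-0 -[1+ n ]    eq = contradiction
    (trans (sym (-‿involutive _)) (trans (-‿cong eq) -0#≈0#)) (ι≉0 n)

  x-y≈0⇒x≈y : ∀ {x y} → x - y ≈ 0# → x ≈ y
  x-y≈0⇒x≈y {x} {y} eq = begin
    x            ≈⟨ solve 2 (λ x y → x := x :- y :+ y) refl x y ⟩
    x - y + y    ≈⟨ +-congʳ eq ⟩
    0# + y       ≈⟨ +-identityˡ y ⟩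
    y            ∎

  x≈y⇒x-y≈0 : ∀ {x y} → x ≈ y → x - y ≈ 0#
  x≈y⇒x-y≈0 {x} {y} eq = trans (+-congʳ eq) (-‿inverseʳ y)

  ι-injective : ∀ {i j} → ι i ≈ ι j → i ≡ j
  ι-injective {i} {j} eq = ℤₚ.i-j≡0⇒i≡j i j
    (ι-injective-0 (i ℤ.- j) (trans (ι-minus i j) (x≈y⇒x-y≈0 eq)))

  *-cancelˡ-0 : ∀ {x y} → ¬ (x ≈ 0#) → x * y ≈ 0# → y ≈ 0#
  *-cancelˡ-0 {x} {y} x≉0 xy≈0 with z , xz≈1 ← inverse x x≉0 = begin
    y              ≈⟨ *-identityˡ y ⟨
    1# * y         ≈⟨ *-congʳ xz≈1 ⟨
    x * z * y      ≈⟨ solve 3 (λ x y z → x :* z :* y := z :* (x :* y)) refl x y z ⟩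
    z * (x * y)    ≈⟨ *-congˡ xy≈0 ⟩
    z * 0#         ≈⟨ zeroʳ z ⟩
    0#             ∎

  *-cancelˡ : ∀ {x y z} → ¬ (x ≈ 0#) → x * y ≈ x * z → y ≈ z
  *-cancelˡ {x} {y} {z} x≉0 eq = x-y≈0⇒x≈y (*-cancelˡ-0 x≉0 (begin
    x * (y - z)      ≈⟨ solve 3 (λ x y z → x :* (y :- z) := x :* y :- x :* z) refl x y z ⟩
    x * y - x * z    ≈⟨ x≈y⇒x-y≈0 eq ⟩
    0#               ∎))

  x²≈0⇒x≈0 : ∀ {x} → x * x ≈ 0# → x ≈ 0#
  x²≈0⇒x≈0 {x} eq = decidable-stable (x ≟ 0#) λ x≉0 → x≉0 (*-cancelˡ-0 x≉0 eq)

  x+x≈0⇒x≈0 : ∀ {x} → x + x ≈ 0# → x ≈ 0#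
  x+x≈0⇒x≈0 {x} eq = *-cancelˡ-0 (ι≉0 1)
    (trans (solve 1 (λ x → con (ℤ.+ 2) :* x := x :+ x) refl x) eq)

  sum-cong : ∀ {n} {f g : Vector R n} → (∀ i → f i ≈ g i) → sum f ≈ sum g
  sum-cong = sum-cong-≋

  sum-zero : ∀ {n} {f : Vector R n} → (∀ i → f i ≈ 0#) → sum f ≈ 0#
  sum-zero {n} f≈0 = trans (sum-cong f≈0) (sum-replicate-zero n)

  sum-minus : ∀ {n} (f g : Vector R n) → sum (λ i → f i - g i) ≈ sum f - sum g
  sum-minus {zero}  f g = sym (-‿inverseʳ 0#)
  sum-minus {suc n} f g = trans (+-congˡ (sum-minus (tail f) (tail g)))
    (solve 4 (λ a b c d → a :- b :+ (c :- d) := a :+ c :- (b :+ d)) refl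
      (f zero) (g zero) (sum (tail f)) (sum (tail g)))

  sum-nonNegative : ∀ {n} (f : Vector R n) → (∀ i → 0# ≤ f i) → 0# ≤ sum f
  sum-nonNegative {zero}  f 0≤f = ≤-refl
  sum-nonNegative {suc n} f 0≤f = ≤-respˡ (+-identityʳ 0#)
    (+-mono (0≤f zero) (sum-nonNegative (tail f) (0≤f ∘ suc)))

  sum≈0⇒≈0 : ∀ {n} (f : Vector R n) → (∀ i → 0# ≤ f i) → sum f ≈ 0# → ∀ i → f i ≈ 0#
  sum≈0⇒≈0 f 0≤f eq zero = antisym
    (≤-respʳ eq (≤-respˡ (+-identityʳ _)
      (+-monoʳ-≤ (f zero) (sum-nonNegative (tail f) (0≤f ∘ suc)))))
    (0≤f zero)
  sum≈0⇒≈0 f 0≤f eq (suc i) = sum≈0⇒≈0 (tail f) (0≤f ∘ suc)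
    (antisym
      (≤-respʳ eq (≤-respˡ (+-identityˡ _) (+-mono (0≤f zero) ≤-refl)))
      (sum-nonNegative (tail f) (0≤f ∘ suc))) i

  δ : ∀ {n} → Fin n → Fin n → R
  δ zero    zero    = 1#
  δ zero    (suc j) = 0#
  δ (suc i) zero    = 0#
  δ (suc i) (suc j) = δ i j

  δ-refl : ∀ {n} (i : Fin n) → δ i i ≈ 1#
  δ-refl zero    = refl
  δ-refl (suc i) = δ-refl i

  δ-≢ : ∀ {n} {i j : Fin n} → i ≢ j → δ i j ≈ 0#
  δ-≢ {i = zero}  {zero}  i≢j = contradiction ≡.refl i≢j
  δ-≢ {i = zero}  {suc j} i≢j = refl
  δ-≢ {i = suc i} {zero}  i≢j = refl
  δ-≢ {i = suc i} {suc j} i≢j = δ-≢ (i≢j ∘ cong suc)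

  δ-sym : ∀ {n} (i j : Fin n) → δ i j ≈ δ j i
  δ-sym zero    zero    = refl
  δ-sym zero    (suc j) = refl
  δ-sym (suc i) zero    = refl
  δ-sym (suc i) (suc j) = δ-sym i j

  sum-δ : ∀ {n} (i : Fin n) (f : Vector R n) → sum (λ j → δ i j * f j) ≈ f i
  sum-δ zero f = begin
    1# * f zero + sum (λ j → 0# * f (suc j))  ≈⟨ +-cong (*-identityˡ _) (sum-zero (λ j → zeroˡ (f (suc j)))) ⟩
    f zero + 0#                               ≈⟨ +-identityʳ _ ⟩
    f zero                                    ∎
  sum-δ (suc i) f = begin
    0# * f zero + sum (λ j → δ i j * f (suc j))  ≈⟨ +-cong (zeroˡ _) (sum-δ i (tail f)) ⟩
    0# + f (suc i)                               ≈⟨ +-identityˡ _ ⟩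
    f (suc i)                                    ∎

  ⟨⟩-cong : ∀ {n} {x x′ y y′ : Vector R n} → x ≋ x′ → y ≋ y′ → ⟨ x , y ⟩ ≈ ⟨ x′ , y′ ⟩
  ⟨⟩-cong x≋x′ y≋y′ = sum-cong λ i → *-cong (x≋x′ i) (y≋y′ i)

  ⟨⟩-congʳ : ∀ {n} (x : Vector R n) {y y′} → y ≋ y′ → ⟨ x , y ⟩ ≈ ⟨ x , y′ ⟩
  ⟨⟩-congʳ x y≋y′ = sum-cong λ i → *-congˡ {x i} (y≋y′ i)

  ⟨⟩-comm : ∀ {n} (x y : Vector R n) → ⟨ x , y ⟩ ≈ ⟨ y , x ⟩
  ⟨⟩-comm x y = sum-cong λ i → *-comm (x i) (y i)

  ⟨⟩-negʳ : ∀ {n} (x y : Vector R n) → ⟨ x , (λ i → - y i) ⟩ ≈ - ⟨ x , y ⟩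
  ⟨⟩-negʳ x y = begin
    ⟨ x , (λ i → - y i) ⟩                    ≈⟨ sum-cong (λ i → solve 2 (λ x y → x :* :- y := con (ℤ.- ℤ.+ 1) :* (x :* y)) refl (x i) (y i)) ⟩
    sum (λ i → ι (ℤ.- ℤ.+ 1) * (x i * y i))  ≈⟨ sym (*-distribˡ-sum (ι (ℤ.- ℤ.+ 1)) (λ i → x i * y i)) ⟩
    ι (ℤ.- ℤ.+ 1) * ⟨ x , y ⟩                ≈⟨ solve 1 (λ s → con (ℤ.- ℤ.+ 1) :* s := :- s) refl ⟨ x , y ⟩ ⟩
    - ⟨ x , y ⟩                              ∎

  ⟨⟩-combination : ∀ {m n} (x : Vector R n) (c : Vector R m) (w : Vector (Vector R n) m) →
    ⟨ x , combination c w ⟩ ≈ ⟨ c , (λ k → ⟨ x , w k ⟩) ⟩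
  ⟨⟩-combination x c w = begin
    sum (λ i → x i * sum (λ k → c k * w k i))
      ≈⟨ sum-cong (λ i → *-distribˡ-sum (x i) (λ k → c k * w k i)) ⟩
    sum (λ i → sum (λ k → x i * (c k * w k i)))
      ≈⟨ ∑-comm (λ i k → x i * (c k * w k i)) ⟩
    sum (λ k → sum (λ i → x i * (c k * w k i)))
      ≈⟨ sum-cong (λ k → trans
           (sum-cong (λ i → solve 3 (λ a b c → a :* (b :* c) := b :* (a :* c)) refl (x i) (c k) (w k i)))
           (sym (*-distribˡ-sum (c k) (λ i → x i * w k i)))) ⟩
    sum (λ k → c k * sum (λ i → x i * w k i)) ∎

-- Dual bases and the exchange of a basis vector.

module DualBases (ℝ : CompleteOrderedField) where

  open FieldProperties ℝ

  -- With `ω` and `η` as rows of matrices, the fields say that each is the inverse transpose of the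
  -- other, from both sides. Keeping both replaces arguments with rank or determinants.
  record Dual {n} (ω η : Vector (Vector R n) n) : Set where
    field
      dual     : ∀ a b → ⟨ η a , ω b ⟩ ≈ δ a b
      complete : ∀ i j → sum (λ a → ω a i * η a j) ≈ δ i j

    expand : ∀ x i → x i ≈ combination (λ a → ⟨ η a , x ⟩) ω i
    expand x i = begin
      x i                                                ≈⟨ sum-δ i x ⟨
      sum (λ j → δ i j * x j)                            ≈⟨ sum-cong (λ j → trans (*-congʳ (sym (complete i j))) (*-distribʳ-sum (x j) (λ a → ω a i * η a j))) ⟩
      sum (λ j → sum (λ a → ω a i * η a j * x j))        ≈⟨ ∑-comm (λ j a → ω a i * η a j * x j) ⟩
      sum (λ a → sum (λ j → ω a i * η a j * x j))        ≈⟨ sum-cong (λ a → trans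
        (sum-cong (λ j → solve 3 (λ p q r → p :* q :* r := q :* r :* p) refl (ω a i) (η a j) (x j)))
        (sym (*-distribʳ-sum (ω a i) (λ j → η a j * x j)))) ⟩
      sum (λ a → ⟨ η a , x ⟩ * ω a i)                    ∎

    dual-expand : ∀ g j → g j ≈ combination (λ a → ⟨ g , ω a ⟩) η j
    dual-expand g j = begin
      g j                                                ≈⟨ sum-δ j g ⟨
      sum (λ i → δ j i * g i)                            ≈⟨ sum-cong (λ i → trans (*-congʳ (trans (δ-sym j i) (sym (complete i j)))) (*-distribʳ-sum (g i) (λ a → ω a i * η a j))) ⟩
      sum (λ i → sum (λ a → ω a i * η a j * g i))        ≈⟨ ∑-comm (λ i a → ω a i * η a j * g i) ⟩
      sum (λ a → sum (λ i → ω a i * η a j * g i))        ≈⟨ sum-cong (λ a → trans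
        (sum-cong (λ i → solve 3 (λ p q r → p :* q :* r := r :* p :* q) refl (ω a i) (η a j) (g i)))
        (sym (*-distribʳ-sum (η a j) (λ i → g i * ω a i)))) ⟩
      sum (λ a → ⟨ g , ω a ⟩ * η a j)                    ∎

    separating : ∀ g → (∀ a → ⟨ g , ω a ⟩ ≈ 0#) → g ≋ 𝟎
    separating g g⊥ω j = trans (dual-expand g j)
      (sum-zero λ a → trans (*-congʳ (g⊥ω a)) (zeroˡ _))

    coordinates : ∀ c a → ⟨ η a , combination c ω ⟩ ≈ c a
    coordinates c a = begin
      ⟨ η a , combination c ω ⟩           ≈⟨ ⟨⟩-combination (η a) c ω ⟩
      sum (λ k → c k * ⟨ η a , ω k ⟩)     ≈⟨ sum-cong (λ k → trans (*-congˡ (dual a k)) (*-comm _ _)) ⟩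
      sum (λ k → δ a k * c k)             ≈⟨ sum-δ a c ⟩
      c a                                 ∎

    injective : ∀ a b → ω a ≋ ω b → a ≡ b
    injective a b eq with a Finₚ.≟ b
    ... | yes a≡b = a≡b
    ... | no  a≢b = contradiction (begin
      0#               ≈⟨ δ-≢ a≢b ⟨
      δ a b            ≈⟨ dual a b ⟨
      ⟨ η a , ω b ⟩    ≈⟨ ⟨⟩-congʳ (η a) eq ⟨
      ⟨ η a , ω a ⟩    ≈⟨ dual a a ⟩
      δ a a            ≈⟨ δ-refl a ⟩
      1#               ∎) 0≉1

  replace : ∀ {A : Set} {n} → Fin n → A → Vector A n → Vector A n
  replace p w ω a with p Finₚ.≟ a
  ... | yes _ = w
  ... | no  _ = ω a

  replace-≡ : ∀ {A : Set} {n} (p : Fin n) (w : A) (ω : Vector A n) → replace p w ω p ≡ w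
  replace-≡ p w ω with p Finₚ.≟ p
  ... | yes _   = ≡.refl
  ... | no  p≢p = contradiction ≡.refl p≢p

  replace-≢ : ∀ {A : Set} {n} {p : Fin n} (w : A) (ω : Vector A n) {a} → p ≢ a → replace p w ω a ≡ ω a
  replace-≢ {p = p} w ω {a} p≢a with p Finₚ.≟ a
  ... | yes p≡a = contradiction p≡a p≢a
  ... | no  _   = ≡.refl

  replace-All : ∀ {A : Set} {P : A → Set} {n} (p : Fin n) {w : A} {ω : Vector A n} →
                P w → (∀ a → P (ω a)) → ∀ a → P (replace p w ω a)
  replace-All p Pw Pω a with p Finₚ.≟ a
  ... | yes _ = Pw
  ... | no  _ = Pω a

  module Pivot {n} {ω η : Vector (Vector R n) n} (D : Dual ω η)
               (p : Fin n) (w : Vector R n) (ηw≉0 : ¬ (⟨ η p , w ⟩ ≈ 0#)) where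

    open Dual D

    private
      s : R
      s = proj₁ (inverse ⟨ η p , w ⟩ ηw≉0)
      u : Vector R n
      u a = ⟨ η a , w ⟩
      ups≈1 : u p * s ≈ 1#
      ups≈1 = proj₂ (inverse ⟨ η p , w ⟩ ηw≉0)

    -- For a = p the formula gives η p / ⟨ η p , w ⟩.
    η′ : Vector (Vector R n) n
    η′ a j = η a j - (u a - δ p a) * (s * η p j)

    private
      W : Vector R n
      W i = w i - ω p i

      replace-δ : ∀ a i → replace p w ω a i ≈ ω a i + δ p a * W i
      replace-δ a i with p Finₚ.≟ a
      ... | yes ≡.refl = begin
        w i                          ≈⟨ solve 2 (λ w o → w := o :+ con (ℤ.+ 1) :* (w :- o)) refl (w i) (ω p i) ⟩
        ω p i + ι (ℤ.+ 1) * W i      ≈⟨ +-congˡ (*-congʳ (trans ι-1 (sym (δ-refl p)))) ⟩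
        ω p i + δ p p * W i          ∎
      ... | no p≢a = begin
        ω a i                    ≈⟨ solve 2 (λ o w → o := o :+ con (ℤ.+ 0) :* w) refl (ω a i) (W i) ⟩
        ω a i + 0# * W i         ≈⟨ +-congˡ (*-congʳ (δ-≢ p≢a)) ⟨
        ω a i + δ p a * W i      ∎

      η′-inner : ∀ a x → ⟨ η′ a , x ⟩ ≈ ⟨ η a , x ⟩ - (u a - δ p a) * s * ⟨ η p , x ⟩
      η′-inner a x = begin
        sum (λ j → η′ a j * x j)
          ≈⟨ sum-cong (λ j → solve 5 (λ e t s h x → (e :- t :* (s :* h)) :* x := e :* x :- t :* s :* (h :* x)) refl
               (η a j) (u a - δ p a) s (η p j) (x j)) ⟩
        sum (λ j → η a j * x j - (u a - δ p a) * s * (η p j * x j))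
          ≈⟨ sum-minus (λ j → η a j * x j) (λ j → (u a - δ p a) * s * (η p j * x j)) ⟩
        ⟨ η a , x ⟩ - sum (λ j → (u a - δ p a) * s * (η p j * x j))
          ≈⟨ +-congˡ (-‿cong (*-distribˡ-sum ((u a - δ p a) * s) (λ j → η p j * x j))) ⟨
        ⟨ η a , x ⟩ - (u a - δ p a) * s * ⟨ η p , x ⟩ ∎

    dual′ : ∀ a b → ⟨ η′ a , replace p w ω b ⟩ ≈ δ a b
    dual′ a b with p Finₚ.≟ b
    ... | yes ≡.refl = begin
      ⟨ η′ a , w ⟩                            ≈⟨ η′-inner a w ⟩
      u a - (u a - δ p a) * s * u p           ≈⟨ solve 4 (λ x d s y → x :- (x :- d) :* s :* y := x :- (x :- d) :* (y :* s)) refl (u a) (δ p a) s (u p) ⟩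
      u a - (u a - δ p a) * (u p * s)         ≈⟨ +-congˡ (-‿cong (*-congˡ (trans ups≈1 (sym ι-1)))) ⟩
      u a - (u a - δ p a) * ι (ℤ.+ 1)         ≈⟨ solve 2 (λ x d → x :- (x :- d) :* con (ℤ.+ 1) := d) refl (u a) (δ p a) ⟩
      δ p a                                   ≈⟨ δ-sym p a ⟩
      δ a p                                   ∎
    ... | no p≢b = begin
      ⟨ η′ a , ω b ⟩                                       ≈⟨ η′-inner a (ω b) ⟩
      ⟨ η a , ω b ⟩ - (u a - δ p a) * s * ⟨ η p , ω b ⟩    ≈⟨ +-cong (dual a b) (-‿cong (*-congˡ (trans (dual p b) (δ-≢ p≢b)))) ⟩
      δ a b - (u a - δ p a) * s * 0#                       ≈⟨ solve 3 (λ d t s → d :- t :* s :* con (ℤ.+ 0) := d) refl (δ a b) (u a - δ p a) s ⟩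
      δ a b                                                ∎

    -- The family `replace p w ω` is `ω` with `w - ω p` added in place `p`. So the sum splits into
    -- the full sum for `ω`, the expansion of `w`, and one term at `p`; what remains is a multiple
    -- of `1 - u p * s`, which vanishes.
    complete′ : ∀ i j → sum (λ a → replace p w ω a i * η′ a j) ≈ δ i j
    complete′ i j = begin
      sum (λ a → replace p w ω a i * η′ a j)
        ≈⟨ sum-cong (λ a → trans (*-congʳ (replace-δ a i))
             (solve 6 (λ o d W e u h → (o :+ d :* W) :* (e :- (u :- d) :* h)
                := o :* e :- u :* o :* h :+ d :* (o :* h :+ W :* (e :- (u :- d) :* h))) refl
               (ω a i) (δ p a) (W i) (η a j) (u a) (s * η p j))) ⟩
      sum (λ a → ω a i * η a j - u a * ω a i * h + δ p a * (ω a i * h + W i * η′ a j))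
        ≈⟨ ∑-distrib-+ (λ a → ω a i * η a j - u a * ω a i * h) _ ⟩
      sum (λ a → ω a i * η a j - u a * ω a i * h) + sum (λ a → δ p a * (ω a i * h + W i * η′ a j))
        ≈⟨ +-cong (sum-minus (λ a → ω a i * η a j) (λ a → u a * ω a i * h))
                  (sum-δ p (λ a → ω a i * h + W i * η′ a j)) ⟩
      sum (λ a → ω a i * η a j) - sum (λ a → u a * ω a i * h) + (ω p i * h + W i * η′ p j)
        ≈⟨ +-cong (+-cong (complete i j)
             (-‿cong (trans (sym (*-distribʳ-sum h (λ a → u a * ω a i))) (*-congʳ (sym (expand w i))))))
             (+-congˡ (*-congˡ (+-congˡ (-‿cong (*-congʳ (+-congˡ (-‿cong (trans (δ-refl p) (sym ι-1))))))))) ⟩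
      δ i j - w i * h + (ω p i * h + W i * (η p j - (u p - ι (ℤ.+ 1)) * h))
        ≈⟨ solve 6 (λ d w o s e u → d :- w :* (s :* e) :+ (o :* (s :* e) :+ (w :- o) :* (e :- (u :- con (ℤ.+ 1)) :* (s :* e)))
             := d :+ (w :- o) :* e :* (con (ℤ.+ 1) :- u :* s)) refl
             (δ i j) (w i) (ω p i) s (η p j) (u p) ⟩
      δ i j + W i * η p j * (ι (ℤ.+ 1) - u p * s)
        ≈⟨ +-congˡ (trans (*-congˡ (x≈y⇒x-y≈0 (trans ι-1 (sym ups≈1)))) (zeroʳ _)) ⟩
      δ i j + 0#
        ≈⟨ +-identityʳ _ ⟩
      δ i j ∎
      where
      h = s * η p j

    pivot : Dual (replace p w ω) η′
    pivot = record { dual = dual′ ; complete = complete′ }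

  -- The dual form of spanning, which perfection yields directly.
  Separating : ∀ {n} → Pred (Vector R n) 0ℓ → Set
  Separating P = ∀ g → (∀ w → P w → ⟨ g , w ⟩ ≈ 0#) → g ≋ 𝟎

  DualIn : ∀ {n} → Pred (Vector R n) 0ℓ → Set
  DualIn {n} P = ∃[ ω ] ∃[ η ] (Dual {n} ω η × (∀ a → P (ω a)))

  δ-Dual : ∀ {n} → Dual {n} δ δ
  δ-Dual = record
    { dual     = λ a b → trans (sum-δ a (λ i → δ b i)) (δ-sym b a)
    ; complete = λ i j → trans (sum-cong (λ a → *-congʳ (δ-sym a i))) (sum-δ i (λ a → δ a j)) }

  -- Starting from the standard basis, the vectors are exchanged one at a time.
  separating⇒dual : ∀ {n} {P : Pred (Vector R n) 0ℓ} → Separating P → ¬ ¬ DualIn P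
  separating⇒dual {n} {P} sep k =
    exchange n ℕₚ.≤-refl λ (ω , η , D , Pω) → k (ω , η , D , λ a → Pω a (Finₚ.toℕ<n a))
    where
    Partial : ℕ → Set
    Partial m = ∃[ ω ] ∃[ η ] (Dual {n} ω η × (∀ a → toℕ a ℕ.< m → P (ω a)))

    exchange : ∀ m → m ℕ.≤ n → ¬ ¬ Partial m
    exchange zero    _   k = k (δ , δ , δ-Dual , λ a ())
    exchange (suc m) m<n k = exchange m (ℕₚ.<⇒≤ m<n) λ (ω , η , D , Pω) →
      let p = fromℕ< m<n
          -- Any `w` in `P` that is not orthogonal to `η p` may take place `p`. Were there none,
          -- `η p` would be orthogonal to all of `P`, hence zero, although its product with `ω p` is
          -- 1.
          extend : ∀ w → P w → ¬ ¬ (⟨ η p , w ⟩ ≈ 0#)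
          extend w Pw ηw≉0 = k (replace p w ω , Pivot.η′ D p w ηw≉0 , Pivot.pivot D p w ηw≉0 , λ a a≤m →
            keep ω p w Pw Pω (Finₚ.toℕ-fromℕ< m<n) a a≤m)
      in 0≉1 (begin
        0#                             ≈⟨ sum-zero (λ i → trans (*-congʳ
          (sep (η p) (λ w Pw → decidable-stable (_ ≟ _) (extend w Pw)) i)) (zeroˡ _)) ⟨
        ⟨ η p , ω p ⟩                  ≈⟨ Dual.dual D p p ⟩
        δ p p                          ≈⟨ δ-refl p ⟩
        1#                             ∎)
      where
      keep : ∀ ω p w → P w → (∀ a → toℕ a ℕ.< m → P (ω a)) → toℕ p ≡ m →
             ∀ a → toℕ a ℕ.< suc m → P (replace p w ω a)
      keep ω p w Pw Pω p≡m a a≤m with p Finₚ.≟ a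
      ... | yes _   = Pw
      ... | no  p≢a = Pω a (ℕₚ.≤∧≢⇒< (ℕₚ.≤-pred a≤m) λ a≡m → p≢a (Finₚ.toℕ-injective (≡.trans p≡m (≡.sym a≡m))))

  -- Symmetric matrices with zero diagonal.

  Matrix : ℕ → Set
  Matrix d = Fin d → Fin d → R

  upper : ∀ d → Matrix d → Vector R (triangle d)
  upper zero    M = λ ()
  upper (suc d) M = (λ j → M zero (suc j)) ++ upper d (λ i j → M (suc i) (suc j))

  -- The symmetric matrix with zero diagonal and strict upper triangle `g`. A difference of two Gram
  -- matrices with equal diagonals has this shape.
  hollow : ∀ d → Vector R (triangle d) → Matrix d
  hollow (suc d) g zero    zero    = 0#
  hollow (suc d) g zero    (suc j) = V.take d g j
  hollow (suc d) g (suc i) zero    = V.take d g i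
  hollow (suc d) g (suc i) (suc j) = hollow d (V.drop d g) i j

  hollow-symmetric : ∀ d g i j → hollow d g i j ≈ hollow d g j i
  hollow-symmetric (suc d) g zero    zero    = refl
  hollow-symmetric (suc d) g zero    (suc j) = refl
  hollow-symmetric (suc d) g (suc i) zero    = refl
  hollow-symmetric (suc d) g (suc i) (suc j) = hollow-symmetric d (V.drop d g) i j

  ⟨,++⟩ : ∀ m {n} (f : Vector R m) (g : Vector R n) (h : Vector R (m ℕ.+ n)) →
          ⟨ h , f ++ g ⟩ ≈ ⟨ V.take m h , f ⟩ + ⟨ V.drop m h , g ⟩
  ⟨,++⟩ zero    f g h = sym (+-identityˡ _)
  ⟨,++⟩ (suc m) f g h = begin
    h zero * f zero + sum (λ i → h (suc i) * (f ++ g) (suc i))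
      ≈⟨ +-congˡ (sum-cong (λ i → *-congˡ (reflexive (++-suc i)))) ⟩
    h zero * f zero + ⟨ tail h , tail f ++ g ⟩
      ≈⟨ +-congˡ (⟨,++⟩ m (tail f) g (tail h)) ⟩
    h zero * f zero + (⟨ V.take m (tail h) , tail f ⟩ + ⟨ V.drop m (tail h) , g ⟩)
      ≈⟨ +-assoc _ _ _ ⟨
    h zero * f zero + ⟨ V.take m (tail h) , tail f ⟩ + ⟨ V.drop m (tail h) , g ⟩ ∎
    where
    ++-suc : ∀ i → (f ++ g) (suc i) ≡ (tail f ++ g) i
    ++-suc i with splitAt m i
    ... | inj₁ _ = ≡.refl
    ... | inj₂ _ = ≡.refl

  outer : ∀ {d} → Vector R d → Vector R d → Matrix d
  outer x y i j = x i * y j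

  bilinear : ∀ {d} → Matrix d → Vector R d → Vector R d → R
  bilinear M x y = sum (λ i → sum (λ j → M i j * (x i * y j)))

  -- Each product of two distinct coordinates occurs twice. So the vanishing of a hollow form at `x`
  -- is one linear equation in the `triangle d` unknowns `g`.
  bilinear-hollow : ∀ d g (x : Vector R d) →
    bilinear (hollow d g) x x ≈ ⟨ g , upper d (outer x x) ⟩ + ⟨ g , upper d (outer x x) ⟩
  bilinear-hollow zero    g x = sym (+-identityˡ 0#)
  bilinear-hollow (suc d) g x = begin
    0# * (x zero * x zero) + row
      + sum (λ i → V.take d g i * (x (suc i) * x zero) + sum (λ j → N i j * (x (suc i) * x (suc j))))
      ≈⟨ +-congˡ (trans (∑-distrib-+ (λ i → V.take d g i * (x (suc i) * x zero)) (λ i → sum (λ j → N i j * (x (suc i) * x (suc j)))))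
           (+-cong (sum-cong (λ i → *-congˡ {V.take d g i} (*-comm (x (suc i)) (x zero))))
                   (bilinear-hollow d (V.drop d g) (tail x)))) ⟩
    0# * (x zero * x zero) + row + (row + (rest + rest))
      ≈⟨ solve 3 (λ z r s → con (ℤ.+ 0) :* z :+ r :+ (r :+ (s :+ s)) := r :+ s :+ (r :+ s)) refl (x zero * x zero) row rest ⟩
    row + rest + (row + rest)
      ≈⟨ +-cong split split ⟨
    ⟨ g , upper (suc d) (outer x x) ⟩ + ⟨ g , upper (suc d) (outer x x) ⟩ ∎
    where
    N = hollow d (V.drop d g)
    row = sum (λ j → V.take d g j * (x zero * x (suc j)))
    rest = ⟨ V.drop d g , upper d (outer (tail x) (tail x)) ⟩
    split = ⟨,++⟩ d (λ j → x zero * x (suc j)) (upper d (outer (tail x) (tail x))) g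

  take-drop≈0 : ∀ m {n} (g : Vector R (m ℕ.+ n)) → V.take m g ≋ 𝟎 → V.drop m g ≋ 𝟎 → g ≋ 𝟎
  take-drop≈0 m {n} g take≈0 drop≈0 i with splitAt m i | Finₚ.join-splitAt m n i
  ... | inj₁ j | ≡.refl = take≈0 j
  ... | inj₂ j | ≡.refl = drop≈0 j

  hollow≈0⇒≈0 : ∀ d g → (∀ i j → hollow d g i j ≈ 0#) → g ≋ 𝟎
  hollow≈0⇒≈0 zero    g eq ()
  hollow≈0⇒≈0 (suc d) g eq = take-drop≈0 d g (λ j → eq zero (suc j))
    (hollow≈0⇒≈0 d (V.drop d g) (λ i j → eq (suc i) (suc j)))

  hollow-cong : ∀ d {g h} → g ≋ h → ∀ i j → hollow d g i j ≈ hollow d h i j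
  hollow-cong (suc d) eq zero    zero    = refl
  hollow-cong (suc d) eq zero    (suc j) = eq (j ↑ˡ triangle d)
  hollow-cong (suc d) eq (suc i) zero    = eq (i ↑ˡ triangle d)
  hollow-cong (suc d) eq (suc i) (suc j) = hollow-cong d (λ k → eq (d ↑ʳ k)) i j

  hollow≈0 : ∀ d {g} → g ≋ 𝟎 → ∀ i j → hollow d g i j ≈ 0#
  hollow≈0 (suc d) eq zero    zero    = refl
  hollow≈0 (suc d) eq zero    (suc j) = eq (j ↑ˡ triangle d)
  hollow≈0 (suc d) eq (suc i) zero    = eq (i ↑ˡ triangle d)
  hollow≈0 (suc d) eq (suc i) (suc j) = hollow≈0 d (λ k → eq (d ↑ʳ k)) i j

  hollow-upper : ∀ d M → (∀ i j → M i j ≈ M j i) → (∀ i → M i i ≈ 0#) →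
                 ∀ i j → hollow d (upper d M) i j ≈ M i j
  hollow-upper (suc d) M symm diag = go
    where
    first : ∀ j → upper (suc d) M (j ↑ˡ triangle d) ≈ M zero (suc j)
    first j = reflexive (cong [ _ , _ ]′ (Finₚ.splitAt-↑ˡ d j (triangle d)))
    go : ∀ i j → hollow (suc d) (upper (suc d) M) i j ≈ M i j
    go zero    zero    = sym (diag zero)
    go zero    (suc j) = first j
    go (suc i) zero    = trans (first i) (symm zero (suc i))
    go (suc i) (suc j) = trans
      (hollow-cong d (λ k → reflexive (cong [ _ , _ ]′ (Finₚ.splitAt-↑ʳ d (triangle d) k))) i j)
      (hollow-upper d (λ i j → M (suc i) (suc j)) (λ i j → symm (suc i) (suc j)) (diag ∘ suc) i j)

  bilinear-cong : ∀ {d} {M N : Matrix d} (x y : Vector R d) → (∀ i j → M i j ≈ N i j) →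
                  bilinear M x y ≈ bilinear N x y
  bilinear-cong x y eq = sum-cong λ i → sum-cong λ j → *-congʳ (eq i j)

  upper-cong : ∀ d {M N} → (∀ i j → M i j ≈ N i j) → upper d M ≋ upper d N
  upper-cong (suc d) eq k with splitAt d k
  ... | inj₁ j = eq zero (suc j)
  ... | inj₂ j = upper-cong d (λ i j → eq (suc i) (suc j)) j

-- Perfect lattices and the quadratic forms vanishing at their minimal vectors.

module PerfectForms (ℝ : CompleteOrderedField) where

  open FieldProperties ℝ
  open DualBases ℝ

  sum-*-sum : ∀ {m n} (f : Vector R m) (g : Vector R n) →
              sum f * sum g ≈ sum (λ i → sum (λ j → f i * g j))
  sum-*-sum f g = trans (*-distribʳ-sum (sum g) f) (sum-cong λ i → *-distribˡ-sum (f i) g)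

  ∑∑-comm : ∀ {k l m n} (F : Fin k → Fin l → Fin m → Fin n → R) →
    sum (λ i → sum (λ j → sum (λ a → sum (F i j a)))) ≈
    sum (λ a → sum (λ b → sum (λ i → sum (λ j → F i j a b))))
  ∑∑-comm F = begin
    sum (λ i → sum (λ j → sum (λ a → sum (F i j a))))
      ≈⟨ sum-cong (λ i → ∑-comm (λ j a → sum (F i j a))) ⟩
    sum (λ i → sum (λ a → sum (λ j → sum (F i j a))))
      ≈⟨ ∑-comm (λ i a → sum (λ j → sum (F i j a))) ⟩
    sum (λ a → sum (λ i → sum (λ j → sum (F i j a))))
      ≈⟨ sum-cong (λ a → sum-cong (λ i → ∑-comm (λ j b → F i j a b))) ⟩
    sum (λ a → sum (λ i → sum (λ b → sum (λ j → F i j a b))))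
      ≈⟨ sum-cong (λ a → ∑-comm (λ i b → sum (λ j → F i j a b))) ⟩
    sum (λ a → sum (λ b → sum (λ i → sum (λ j → F i j a b)))) ∎

  bilinear-vectors-cong : ∀ {d} (M : Matrix d) {x x′ y y′ : Vector R d} → x ≋ x′ → y ≋ y′ →
                          bilinear M x y ≈ bilinear M x′ y′
  bilinear-vectors-cong M eq eq′ = sum-cong λ i → sum-cong λ j → *-congˡ {M i j} (*-cong (eq i) (eq′ j))

  bilinear-sym : ∀ {d} (M : Matrix d) → (∀ i j → M i j ≈ M j i) → ∀ x y → bilinear M x y ≈ bilinear M y x
  bilinear-sym M symm x y = trans (∑-comm (λ i j → M i j * (x i * y j)))
    (sum-cong λ j → sum-cong λ i → *-cong (symm i j) (*-comm (x i) (y j)))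

  bilinear-δ : ∀ {d} (M : Matrix d) c e → bilinear M (δ c) (δ e) ≈ M c e
  bilinear-δ M c e = begin
    sum (λ a → sum (λ b → M a b * (δ c a * δ e b)))
      ≈⟨ sum-cong (λ a → trans
           (sum-cong (λ b → solve 3 (λ m p q → m :* (p :* q) := p :* (q :* m)) refl (M a b) (δ c a) (δ e b)))
           (trans (sym (*-distribˡ-sum (δ c a) (λ b → δ e b * M a b))) (*-congˡ (sum-δ e (M a))))) ⟩
    sum (λ a → δ c a * M a e)
      ≈⟨ sum-δ c (λ a → M a e) ⟩
    M c e ∎

  bilinear-pullback : ∀ {m n} (M : Matrix m) (η : Vector (Vector R n) m) (x y : Vector R n) →
    bilinear (λ i j → bilinear M (λ a → η a i) (λ a → η a j)) x y ≈
    bilinear M (λ a → ⟨ η a , x ⟩) (λ a → ⟨ η a , y ⟩)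
  bilinear-pullback M η x y = begin
    sum (λ i → sum (λ j → bilinear M (λ a → η a i) (λ a → η a j) * (x i * y j)))
      ≈⟨ sum-cong (λ i → sum-cong (λ j → trans
           (*-distribʳ-sum (x i * y j) (λ a → sum (λ b → M a b * (η a i * η b j))))
           (sum-cong (λ a → *-distribʳ-sum (x i * y j) (λ b → M a b * (η a i * η b j)))))) ⟩
    sum (λ i → sum (λ j → sum (λ a → sum (λ b → M a b * (η a i * η b j) * (x i * y j)))))
      ≈⟨ ∑∑-comm (λ i j a b → M a b * (η a i * η b j) * (x i * y j)) ⟩
    sum (λ a → sum (λ b → sum (λ i → sum (λ j → M a b * (η a i * η b j) * (x i * y j)))))
      ≈⟨ sum-cong (λ a → sum-cong (λ b → collect a b)) ⟩
    sum (λ a → sum (λ b → M a b * (⟨ η a , x ⟩ * ⟨ η b , y ⟩))) ∎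
    where
    collect : ∀ a b → sum (λ i → sum (λ j → M a b * (η a i * η b j) * (x i * y j))) ≈
                      M a b * (⟨ η a , x ⟩ * ⟨ η b , y ⟩)
    collect a b = begin
      sum (λ i → sum (λ j → M a b * (η a i * η b j) * (x i * y j)))
        ≈⟨ sum-cong (λ i → trans
             (sum-cong (λ j → solve 5 (λ m p q x y → m :* (p :* q) :* (x :* y) := m :* (p :* x :* (q :* y))) refl
               (M a b) (η a i) (η b j) (x i) (y j)))
             (sym (*-distribˡ-sum (M a b) (λ j → η a i * x i * (η b j * y j))))) ⟩
      sum (λ i → M a b * sum (λ j → η a i * x i * (η b j * y j)))
        ≈⟨ *-distribˡ-sum (M a b) (λ i → sum (λ j → η a i * x i * (η b j * y j))) ⟨
      M a b * sum (λ i → sum (λ j → η a i * x i * (η b j * y j)))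
        ≈⟨ *-congˡ (sum-*-sum (λ i → η a i * x i) (λ j → η b j * y j)) ⟨
      M a b * (⟨ η a , x ⟩ * ⟨ η b , y ⟩) ∎

  inner-combination : ∀ {m n} (w : Vector (Vector R n) m) (c e : Vector R m) →
    ⟨ combination c w , combination e w ⟩ ≈ bilinear (λ a b → ⟨ w a , w b ⟩) c e
  inner-combination w c e = begin
    ⟨ combination c w , combination e w ⟩
      ≈⟨ ⟨⟩-combination (combination c w) e w ⟩
    sum (λ b → e b * ⟨ combination c w , w b ⟩)
      ≈⟨ sum-cong (λ b → trans
           (*-congˡ {e b} (trans (⟨⟩-comm (combination c w) (w b)) (⟨⟩-combination (w b) c w)))
           (*-distribˡ-sum (e b) (λ a → c a * ⟨ w b , w a ⟩))) ⟩
    sum (λ b → sum (λ a → e b * (c a * ⟨ w b , w a ⟩)))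
      ≈⟨ ∑-comm (λ b a → e b * (c a * ⟨ w b , w a ⟩)) ⟩
    sum (λ a → sum (λ b → e b * (c a * ⟨ w b , w a ⟩)))
      ≈⟨ sum-cong (λ a → sum-cong (λ b → trans
           (solve 3 (λ e c w → e :* (c :* w) := w :* (c :* e)) refl (e b) (c a) (⟨ w b , w a ⟩))
           (*-congʳ (⟨⟩-comm (w b) (w a))))) ⟩
    bilinear (λ a b → ⟨ w a , w b ⟩) c e ∎

  -- The coefficients with which the norm of a minimal vector `v` involves the off-diagonal entries
  -- of the Gram matrix of the basis dual to `η`, up to the factor 2.
  OffDiagonal : ∀ {d} → Lattice d → Vector (Vector R d) d → Pred (Vector R (triangle d)) 0ℓ
  OffDiagonal {d} Λ η u =
    ∃[ v ] (Minimal Λ v × u ≋ upper d (outer (λ a → ⟨ η a , v ⟩) (λ a → ⟨ η a , v ⟩)))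

  module _ {d} {Λ : Lattice d} (perfect : Perfect Λ) where

    -- A symmetric tensor is a combination of squares of minimal vectors, so a
    -- form vanishing at these is orthogonal to itself.
    perfect⇒form≈0 : (g : Matrix d) → (∀ i j → g i j ≈ g j i) →
                     (∀ v → Minimal Λ v → bilinear g v v ≈ 0#) → ∀ i j → g i j ≈ 0#
    perfect⇒form≈0 g symm g⊥ i j
      with n , c , w , w∈ , g≋ ← perfect (λ (i , j) → g i j) symm
      = x²≈0⇒x≈0 (sum≈0⇒≈0 (λ j → g i j * g i j) (λ j → 0≤x² (g i j))
          (sum≈0⇒≈0 (λ i → sum (λ j → g i j * g i j))
            (λ i → sum-nonNegative (λ j → g i j * g i j) (λ j → 0≤x² (g i j))) total≈0 i) j)
      where
      total≈0 : sum (λ i → sum (λ j → g i j * g i j)) ≈ 0#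
      total≈0 = begin
        sum (λ i → sum (λ j → g i j * g i j))
          ≈⟨ sum-cong (λ i → trans (sum-cong (λ j → *-congˡ {g i j} (g≋ (i , j))))
               (⟨⟩-combination (g i) c (λ k j → w k (i , j)))) ⟩
        sum (λ i → sum (λ k → c k * sum (λ j → g i j * w k (i , j))))
          ≈⟨ ∑-comm (λ i k → c k * sum (λ j → g i j * w k (i , j))) ⟩
        sum (λ k → sum (λ i → c k * sum (λ j → g i j * w k (i , j))))
          ≈⟨ sum-zero (λ k → trans (sym (*-distribˡ-sum (c k) (λ i → sum (λ j → g i j * w k (i , j)))))
               (trans (*-congˡ (trans
                 (sum-cong (λ i → sum-cong (λ j → *-congˡ {g i j} (proj₂ (proj₂ (w∈ k)) (i , j)))))
                 (g⊥ (proj₁ (w∈ k)) (proj₁ (proj₂ (w∈ k)))))) (zeroʳ (c k)))) ⟩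
        0# ∎

    -- The form `outer g g` takes the value `⟨ g , v ⟩ * ⟨ g , v ⟩` at `v`, so orthogonality to the
    -- minimal vectors makes it vanish, and its diagonal consists of the squares of the `g i`. Thus
    -- minimal vectors of a perfect lattice contain a basis of ℝᵈ.
    minimal-separating : Separating (Minimal Λ)
    minimal-separating g g⊥ i = x²≈0⇒x≈0
      (perfect⇒form≈0 (outer g g) (λ i j → *-comm (g i) (g j))
        (λ v v∈ → begin
          bilinear (outer g g) v v
            ≈⟨ sum-cong (λ i → sum-cong (λ j → solve 4 (λ a b x y → a :* b :* (x :* y) := a :* x :* (b :* y)) refl
                 (g i) (g j) (v i) (v j))) ⟩
          sum (λ i → sum (λ j → g i * v i * (g j * v j)))
            ≈⟨ sum-*-sum (λ i → g i * v i) (λ j → g j * v j) ⟨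
          ⟨ g , v ⟩ * ⟨ g , v ⟩
            ≈⟨ trans (*-congˡ (g⊥ v v∈)) (zeroʳ _) ⟩
          0# ∎) i i)

    -- Read `g` as a hollow form in coordinates with respect to `b` and transport it to the form `h`
    -- on ℝᵈ. Orthogonality says that `h` vanishes at all minimal vectors, so `h` is zero by
    -- perfection, and its values at pairs from `b` are the entries of `hollow d g`.
    offDiagonal-separating : ∀ {b η} → Dual b η → Separating (OffDiagonal Λ η)
    offDiagonal-separating {b} {η} D g g⊥ = hollow≈0⇒≈0 d g λ a c → begin
      M a c                                                    ≈⟨ bilinear-δ M a c ⟨
      bilinear M (δ a) (δ c)                                   ≈⟨ bilinear-vectors-cong M (ξ a) (ξ c) ⟨
      bilinear M (λ e → ⟨ η e , b a ⟩) (λ e → ⟨ η e , b c ⟩)   ≈⟨ bilinear-pullback M η (b a) (b c) ⟨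
      bilinear h (b a) (b c)                                   ≈⟨ sum-zero (λ i → sum-zero (λ j → trans (*-congʳ (h≈0 i j)) (zeroˡ _))) ⟩
      0#                                                       ∎
      where
      M = hollow d g
      ξ : ∀ a e → ⟨ η e , b a ⟩ ≈ δ a e
      ξ a e = trans (Dual.dual D e a) (δ-sym e a)
      h : Matrix d
      h i j = bilinear M (λ a → η a i) (λ a → η a j)
      h≈0 : ∀ i j → h i j ≈ 0#
      h≈0 = perfect⇒form≈0 h
        (λ i j → bilinear-sym M (hollow-symmetric d g) (λ a → η a i) (λ a → η a j))
        λ v v∈ → let
          x = λ a → ⟨ η a , v ⟩
          ⊥v = g⊥ (upper d (outer x x)) (v , v∈ , λ _ → refl)
        in begin
          bilinear h v v    ≈⟨ bilinear-pullback M η v v ⟩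
          bilinear M x x    ≈⟨ bilinear-hollow d g x ⟩
          _ + _             ≈⟨ +-cong ⊥v ⊥v ⟩
          0# + 0#           ≈⟨ +-identityˡ 0# ⟩
          0#                ∎

-- Hermite normal forms and their codes.

-- Upper triangular integer matrices, given by the first row and the remaining
-- principal minor; the first diagonal entry of cons p r A is suc p.
data Triangular : ℕ → Set where
  []   : Triangular 0
  cons : ∀ {d} (p : ℕ) (r : Vec ℤ d) (A : Triangular d) → Triangular (suc d)

det : ∀ {d} → Triangular d → ℕ
det []           = 1
det (cons p r A) = suc p ℕ.* det A

multiple-small : ∀ {p} (a a′ : Fin (suc p)) c → ℤ.+ toℕ a ℤ.- ℤ.+ toℕ a′ ≡ ℤ.+ suc p ℤ.* c → a ≡ a′
multiple-small {p} a a′ c eq with c ℤ.≟ ℤ.0ℤ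
... | yes ≡.refl = Finₚ.toℕ-injective (ℤₚ.+-injective
  (ℤₚ.i-j≡0⇒i≡j _ _ (≡.trans eq (ℤₚ.*-zeroʳ (ℤ.+ suc p)))))
... | no  c≢0    = contradiction (begin-strict
  suc p                                    ≡⟨ ℕₚ.*-identityʳ (suc p) ⟨
  suc p ℕ.* 1                              ≤⟨ ℕₚ.*-monoʳ-≤ (suc p) (ℕₚ.n≢0⇒n>0 (c≢0 ∘ ℤₚ.∣i∣≡0⇒i≡0)) ⟩
  suc p ℕ.* ℤ.∣ c ∣                        ≡⟨ ℤₚ.abs-* (ℤ.+ suc p) c ⟨
  ℤ.∣ ℤ.+ suc p ℤ.* c ∣                    ≡⟨ cong ℤ.∣_∣ eq ⟨
  ℤ.∣ ℤ.+ toℕ a ℤ.- ℤ.+ toℕ a′ ∣           ≡⟨ cong ℤ.∣_∣ (ℤₚ.[+m]-[+n]≡m⊖n (toℕ a) (toℕ a′)) ⟩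
  ℤ.∣ toℕ a ℤ.⊖ toℕ a′ ∣                   ≤⟨ ℤₚ.∣m⊝n∣≤m⊔n (toℕ a) (toℕ a′) ⟩
  toℕ a ℕ.⊔ toℕ a′                         <⟨ ℕₚ.⊔-pres-<m (Finₚ.toℕ<n a) (Finₚ.toℕ<n a′) ⟩
  suc p                                    ∎) (ℕₚ.<-irrefl ≡.refl)
  where open ℕₚ.≤-Reasoning

-- The m-th point of the box Πᵢ {0 , … , Aᵢᵢ - 1}.
digits : ∀ {d} (A : Triangular d) → Fin (det A) → Vec ℤ d
digits []           m = []
digits (cons p r A) m = ℤ.+ toℕ (proj₁ am) ∷ digits A (proj₂ am)
  where am = remQuot {suc p} (det A) m

digits-combine : ∀ {d} p r (A : Triangular d) (a : Fin (suc p)) m →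
                 digits (cons p r A) (combine a m) ≡ ℤ.+ toℕ a ∷ digits A m
digits-combine p r A a m =
  cong (λ am → ℤ.+ toℕ (proj₁ am) ∷ digits A (proj₂ am)) (Finₚ.remQuot-combine {suc p} a m)

-- Hermite normal form: the entries to the right of the diagonal are reduced
-- modulo the diagonal entry below them.
data Reduced : ∀ {d} → Triangular d → Set where
  []   : Reduced []
  cons : ∀ {d} p {A : Triangular d} (m : Fin (det A)) → Reduced A → Reduced (cons p (digits A m) A)

module _ {I : ℕ} where

  minor≤ : ∀ {d} p {A : Triangular d} → suc p ℕ.* det A ℕ.≤ I → det A ℕ.≤ I
  minor≤ p {A} ≤I = ℕₚ.≤-trans (ℕₚ.m≤m+n (det A) (p ℕ.* det A)) ≤I

  rowCode : ∀ {d} p (A : Triangular d) → suc p ℕ.* det A ℕ.≤ I → Fin (det A) → Fin I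
  rowCode p A ≤I m = inject≤ (combine (fromℕ p) m) ≤I

  rowCode-injective : ∀ {d} {p p′} {A : Triangular d} ≤I ≤I′ {m m′} →
    rowCode p A ≤I m ≡ rowCode p′ A ≤I′ m′ → p ≡ p′ × m ≡ m′
  rowCode-injective {p = p} {p′} {A} ≤I ≤I′ {m} {m′} eq =
    ≡.trans (≡.sym (Finₚ.toℕ-fromℕ< p<)) (≡.trans (cong toℕ (proj₁ both)) (Finₚ.toℕ-fromℕ< p′<)) , proj₂ both
    where
    -- The leading digits `fromℕ p` and `fromℕ p′` have different types; both are moved to
    -- `Fin (suc (p + p′))`, where `combine` can be inverted.
    p< : p ℕ.< suc (p ℕ.+ p′)
    p< = ℕ.s≤s (ℕₚ.m≤m+n p p′)
    p′< : p′ ℕ.< suc (p ℕ.+ p′)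
    p′< = ℕ.s≤s (ℕₚ.m≤n+m p′ p)
    value : ∀ {k} p (p< : p ℕ.< k) ≤I (m : Fin (det A)) → toℕ (rowCode p A ≤I m) ≡ toℕ (combine (fromℕ< p<) m)
    value p p< ≤I m = begin
      toℕ (rowCode p A ≤I m)                ≡⟨ Finₚ.toℕ-inject≤ _ ≤I ⟩
      toℕ (combine (fromℕ p) m)             ≡⟨ Finₚ.toℕ-combine (fromℕ p) m ⟩
      det A ℕ.* toℕ (fromℕ p) ℕ.+ toℕ m     ≡⟨ cong (λ x → det A ℕ.* x ℕ.+ toℕ m) (≡.trans (Finₚ.toℕ-fromℕ p) (≡.sym (Finₚ.toℕ-fromℕ< p<))) ⟩
      det A ℕ.* toℕ (fromℕ< p<) ℕ.+ toℕ m   ≡⟨ Finₚ.toℕ-combine (fromℕ< p<) m ⟨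
      toℕ (combine (fromℕ< p<) m)           ∎
      where open ≡.≡-Reasoning
    both = Finₚ.combine-injective (fromℕ< p<) m (fromℕ< p′<) m′
      (Finₚ.toℕ-injective (≡.trans (≡.sym (value p p< ≤I m)) (≡.trans (cong toℕ eq) (value p′ p′< ≤I′ m′))))

  code : ∀ {d} {A : Triangular d} → Reduced A → det A ℕ.≤ I → Vector (Fin I) d
  code (cons p {A} m red) ≤I zero    = rowCode p A ≤I m
  code (cons p {A} m red) ≤I (suc i) = code red (minor≤ p {A} ≤I) i

  -- Decoding goes from the last row upwards: the determinant of the rows below is the modulus that
  -- separates the diagonal entry from the rest of a row.
  code-injective : ∀ {d} {A A′ : Triangular d} (red : Reduced A) (red′ : Reduced A′) ≤I ≤I′ →
    (∀ i → code red ≤I i ≡ code red′ ≤I′ i) → A ≡ A′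
  code-injective []                []                   ≤I ≤I′ eq = ≡.refl
  code-injective (cons p {A} m red) (cons p′ {A′} m′ red′) ≤I ≤I′ eq
    with ≡.refl ← code-injective red red′ (minor≤ p {A} ≤I) (minor≤ p′ {A′} ≤I′) (eq ∘ suc)
    with ≡.refl , ≡.refl ← rowCode-injective {p = p} {p′} {A} ≤I ≤I′ {m} {m′} (eq zero) = ≡.refl

-- Triangular systems and residues modulo a triangular matrix.

module TriangularSystems (ℝ : CompleteOrderedField) where

  open FieldProperties ℝ

  infixr 7 _▷_ _⊛_

  -- A ▷ u = Aᵀu and A ⊛ x = Ax.
  _▷_ : ∀ {d} → Triangular d → Vector R d → Vector R d
  (cons p r A ▷ u) zero    = ι (ℤ.+ suc p) * u zero
  (cons p r A ▷ u) (suc j) = ι (lookup r j) * u zero + (A ▷ tail u) j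

  _⊛_ : ∀ {d} → Triangular d → Vector R d → Vector R d
  (cons p r A ⊛ x) zero    = ι (ℤ.+ suc p) * x zero + sum (λ j → ι (lookup r j) * x (suc j))
  (cons p r A ⊛ x) (suc i) = (A ⊛ tail x) i

  ⊛-cong : ∀ {d} (A : Triangular d) {x y} → x ≋ y → A ⊛ x ≋ A ⊛ y
  ⊛-cong (cons p r A) eq zero    = +-cong (*-congˡ (eq zero)) (sum-cong λ j → *-congˡ (eq (suc j)))
  ⊛-cong (cons p r A) eq (suc i) = ⊛-cong A (eq ∘ suc) i

  ⊛-minus : ∀ {d} (A : Triangular d) x y → A ⊛ (λ i → x i - y i) ≋ (λ i → (A ⊛ x) i - (A ⊛ y) i)
  ⊛-minus (cons p r A) x y zero = begin
    q * (x zero - y zero) + sum (λ j → ι (lookup r j) * (x (suc j) - y (suc j)))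
      ≈⟨ +-congˡ (trans
           (sum-cong (λ j → solve 3 (λ r x y → r :* (x :- y) := r :* x :- r :* y) refl (ι (lookup r j)) (x (suc j)) (y (suc j))))
           (sum-minus (λ j → ι (lookup r j) * x (suc j)) (λ j → ι (lookup r j) * y (suc j)))) ⟩
    q * (x zero - y zero) + (s - t)
      ≈⟨ solve 5 (λ q x y s t → q :* (x :- y) :+ (s :- t) := q :* x :+ s :- (q :* y :+ t)) refl q (x zero) (y zero) s t ⟩
    q * x zero + s - (q * y zero + t) ∎
    where
    q = ι (ℤ.+ suc p)
    s = sum (λ j → ι (lookup r j) * x (suc j))
    t = sum (λ j → ι (lookup r j) * y (suc j))
  ⊛-minus (cons p r A) x y (suc i) = ⊛-minus A (tail x) (tail y) i

  ▷-shear : ∀ {d} (A : Triangular d) u t z → A ▷ (λ i → u i + t i * z) ≋ (λ j → (A ▷ u) j + (A ▷ t) j * z)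
  ▷-shear (cons p r A) u t z zero = solve 4 (λ q u t z → q :* (u :+ t :* z) := q :* u :+ q :* t :* z) refl
    (ι (ℤ.+ suc p)) (u zero) (t zero) z
  ▷-shear (cons p r A) u t z (suc j) = trans (+-congˡ (▷-shear A (tail u) (tail t) z j))
    (solve 6 (λ r u t z a b → r :* (u :+ t :* z) :+ (a :+ b :* z) := r :* u :+ a :+ (r :* t :+ b) :* z) refl
      (ι (lookup r j)) (u zero) (t zero) z ((A ▷ tail u) j) ((A ▷ tail t) j))

  adjoint : ∀ {d} (A : Triangular d) x u → ⟨ x , A ▷ u ⟩ ≈ ⟨ A ⊛ x , u ⟩
  adjoint []           x u = refl
  adjoint (cons p r A) x u = begin
    x zero * (q * u zero) + sum (λ j → x (suc j) * (ρ j * u zero + (A ▷ tail u) j))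
      ≈⟨ +-congˡ (trans
           (sum-cong (λ j → solve 4 (λ x r u a → x :* (r :* u :+ a) := r :* x :* u :+ x :* a) refl
             (x (suc j)) (ρ j) (u zero) ((A ▷ tail u) j)))
           (trans (∑-distrib-+ (λ j → ρ j * x (suc j) * u zero) (λ j → x (suc j) * (A ▷ tail u) j))
             (+-cong (sym (*-distribʳ-sum (u zero) (λ j → ρ j * x (suc j)))) (adjoint A (tail x) (tail u))))) ⟩
    x zero * (q * u zero) + (s * u zero + ⟨ A ⊛ tail x , tail u ⟩)
      ≈⟨ solve 5 (λ x q u s t → x :* (q :* u) :+ (s :* u :+ t) := (q :* x :+ s) :* u :+ t) refl
           (x zero) q (u zero) s ⟨ A ⊛ tail x , tail u ⟩ ⟩
    (q * x zero + s) * u zero + ⟨ A ⊛ tail x , tail u ⟩ ∎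
    where
    q = ι (ℤ.+ suc p)
    ρ = λ j → ι (lookup r j)
    s = sum (λ j → ρ j * x (suc j))

  ⊛-injective₀ : ∀ {d} (A : Triangular d) {x} → A ⊛ x ≋ 𝟎 → x ≋ 𝟎
  ⊛-injective₀ (cons p r A) {x} eq = λ { zero → x₀≈0 ; (suc i) → tail≈0 i }
    where
    tail≈0 = ⊛-injective₀ A (eq ∘ suc)
    x₀≈0 = *-cancelˡ-0 (ι≉0 p) (begin
      ι (ℤ.+ suc p) * x zero                                                  ≈⟨ +-identityʳ _ ⟨
      ι (ℤ.+ suc p) * x zero + 0#                                             ≈⟨ +-congˡ (sum-zero (λ j → trans (*-congˡ (tail≈0 j)) (zeroʳ (ι (lookup r j))))) ⟨
      ι (ℤ.+ suc p) * x zero + sum (λ j → ι (lookup r j) * x (suc j))         ≈⟨ eq zero ⟩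
      0#                                                                      ∎)

  ⊛-injective : ∀ {d} (A : Triangular d) {x y} → A ⊛ x ≋ A ⊛ y → x ≋ y
  ⊛-injective A {x} {y} eq i = x-y≈0⇒x≈y
    (⊛-injective₀ A (λ i → trans (⊛-minus A x y i) (x≈y⇒x-y≈0 (eq i))) i)

  ⊛-surjective : ∀ {d} (A : Triangular d) y → ∃[ x ] A ⊛ x ≋ y
  ⊛-surjective []           y = y , λ ()
  ⊛-surjective (cons p r A) y
    with x , eq ← ⊛-surjective A (tail y)
    with z , qz≈1 ← inverse (ι (ℤ.+ suc p)) (ι≉0 p)
    = (z * (y zero - s) V.∷ x) , λ { zero → first ; (suc i) → eq i }
    where
    s = sum (λ j → ι (lookup r j) * x j)
    first : ι (ℤ.+ suc p) * (z * (y zero - s)) + s ≈ y zero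
    first = begin
      ι (ℤ.+ suc p) * (z * (y zero - s)) + s    ≈⟨ solve 4 (λ q z y s → q :* (z :* (y :- s)) :+ s := q :* z :* (y :- s) :+ s) refl _ z (y zero) s ⟩
      ι (ℤ.+ suc p) * z * (y zero - s) + s      ≈⟨ +-congʳ (trans (*-congʳ qz≈1) (*-identityˡ _)) ⟩
      y zero - s + s                            ≈⟨ solve 2 (λ y s → y :- s :+ s := y) refl (y zero) s ⟩
      y zero                                    ∎

  sum-integral : ∀ {n} (r : Vec ℤ n) (t : Vector ℤ n) → ∃[ k ] sum (λ j → ι (lookup r j) * ι (t j)) ≈ ι k
  sum-integral []      t = ℤ.0ℤ , refl
  sum-integral (a ∷ r) t with k , eq ← sum-integral r (tail t) =
    a ℤ.* t zero ℤ.+ k , sym (trans (ι-+ (a ℤ.* t zero) k) (+-cong (ι-* a (t zero)) (sym eq)))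

  ι-remainder : ∀ n p → ι n ≈ ι (ℤ.+ (n %ℕ suc p)) + ι (ℤ.+ suc p) * ι (n /ℕ suc p)
  ι-remainder n p = begin
    ι n                                                       ≡⟨ cong ι (a≡a%ℕn+[a/ℕn]*n n (suc p)) ⟩
    ι (ℤ.+ (n %ℕ suc p) ℤ.+ (n /ℕ suc p) ℤ.* ℤ.+ suc p)       ≈⟨ ι-+ (ℤ.+ (n %ℕ suc p)) ((n /ℕ suc p) ℤ.* ℤ.+ suc p) ⟩
    ι (ℤ.+ (n %ℕ suc p)) + ι ((n /ℕ suc p) ℤ.* ℤ.+ suc p)     ≈⟨ +-congˡ (trans (ι-* (n /ℕ suc p) (ℤ.+ suc p)) (*-comm _ _)) ⟩
    ι (ℤ.+ (n %ℕ suc p)) + ι (ℤ.+ suc p) * ι (n /ℕ suc p)     ∎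

  remainderFin : ∀ (n : ℤ) p → Fin (suc p)
  remainderFin n p = fromℕ< (n%ℕd<d n (suc p))

  remainderFin-toℕ : ∀ n p → ι (ℤ.+ toℕ (remainderFin n p)) ≈ ι (ℤ.+ (n %ℕ suc p))
  remainderFin-toℕ n p = reflexive (cong (ι ∘ ℤ.+_) (Finₚ.toℕ-fromℕ< (n%ℕd<d n (suc p))))

  -- Back substitution with division with remainder: the box represents every class of integer
  -- vectors modulo the image of `A`.
  reduce : ∀ {d} (A : Triangular d) (y : Vector ℤ d) →
    ∃[ m ] Σ[ t ∈ Vector ℤ d ] (∀ i → ι (y i) ≈ ι (lookup (digits A m) i) + (A ⊛ (ι ∘ t)) i)
  reduce []           y = zero , (λ ()) , λ ()
  reduce (cons p r A) y
    with m , t , eq ← reduce A (tail y)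
    with k , s≈k ← sum-integral r t
    = combine a m , (n /ℕ suc p V.∷ t) , λ { zero → first ; (suc i) → trans (eq i)
        (+-congʳ (reflexive (cong (λ v → ι (lookup v (suc i))) (≡.sym (digits-combine p r A a m))))) }
    where
    -- Here `k` is what the quotients of the later coordinates contribute to the first row; it is
    -- removed before dividing by the diagonal entry.
    n = y zero ℤ.- k
    a = remainderFin n p
    first = begin
      ι (y zero)          ≈⟨ solve 2 (λ y k → y := y :- k :+ k) refl _ (ι k) ⟩
      ι (y zero) - ι k + ι k ≈⟨ +-cong (sym (ι-minus (y zero) k)) (sym s≈k) ⟩
      ι n + _             ≈⟨ +-congʳ (trans (ι-remainder n p) (+-congʳ (sym (remainderFin-toℕ n p)))) ⟩
      ι (ℤ.+ toℕ a) + ι (ℤ.+ suc p) * ι (n /ℕ suc p) + _   ≈⟨ +-assoc _ _ _ ⟩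
      ι (ℤ.+ toℕ a) + _   ≈⟨ +-congʳ (reflexive (cong (λ v → ι (lookup v zero)) (≡.sym (digits-combine p r A a m)))) ⟩
      _                   ∎

  -- The transposed system is solved from the first coordinate on: its quotient is fixed at once,
  -- and its multiple of `r` is subtracted from the other coordinates. This is what reduces a row of
  -- the Hermite form.
  reduceᵀ : ∀ {d} (A : Triangular d) (y : Vector ℤ d) →
    ∃[ m ] Σ[ t ∈ Vector ℤ d ] (∀ j → ι (y j) ≈ ι (lookup (digits A m) j) + (A ▷ (ι ∘ t)) j)
  reduceᵀ []           y = zero , (λ ()) , λ ()
  reduceᵀ (cons p r A) y
    with m , t , eq ← reduceᵀ A (λ j → y (suc j) ℤ.- lookup r j ℤ.* (y zero /ℕ suc p))
    = combine a m , (k V.∷ t) , λ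
        { zero → begin
            ι (y zero)                                 ≈⟨ ι-remainder (y zero) p ⟩
            _                                          ≈⟨ +-congʳ (trans (sym (remainderFin-toℕ (y zero) p))
              (reflexive (cong (λ v → ι (lookup v zero)) (≡.sym (digits-combine p r A a m))))) ⟩
            _                                          ∎
        ; (suc j) → begin
            ι (y (suc j))
              ≈⟨ solve 2 (λ y k → y := y :- k :+ k) refl _ (ι (lookup r j) * ι k) ⟩
            ι (y (suc j)) - ι (lookup r j) * ι k + ι (lookup r j) * ι k
              ≈⟨ +-congʳ (trans (+-congˡ (-‿cong (sym (ι-* (lookup r j) k)))) (sym (ι-minus (y (suc j)) (lookup r j ℤ.* k)))) ⟩
            ι (y (suc j) ℤ.- lookup r j ℤ.* k) + ι (lookup r j) * ι k
              ≈⟨ +-congʳ (eq j) ⟩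
            ι (lookup (digits A m) j) + (A ▷ (ι ∘ t)) j + ι (lookup r j) * ι k
              ≈⟨ solve 3 (λ a b c → a :+ b :+ c := a :+ (c :+ b)) refl _ ((A ▷ (ι ∘ t)) j) (ι (lookup r j) * ι k) ⟩
            ι (lookup (digits A m) j) + (ι (lookup r j) * ι k + (A ▷ (ι ∘ t)) j)
              ≈⟨ +-congʳ (reflexive (cong (λ v → ι (lookup v (suc j))) (≡.sym (digits-combine p r A a m)))) ⟩
            _ ∎ }
    where
    k = y zero /ℕ suc p
    a = remainderFin (y zero) p

  -- By induction from the last row, the later entries of `c` vanish. The first row then equates a
  -- difference of two digits with a multiple of the diagonal entry, so `c zero` vanishes as well;
  -- the vanishing of `c` is carried along in `go`.
  box-injective : ∀ {d} (A : Triangular d) m m′ (c : Vector ℤ d) →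
    (∀ i → ι (lookup (digits A m) i) - ι (lookup (digits A m′) i) ≈ (A ⊛ (ι ∘ c)) i) → m ≡ m′
  box-injective A m m′ c eq = proj₁ (go A m m′ c eq)
    where
    go : ∀ {d} (A : Triangular d) m m′ (c : Vector ℤ d) →
      (∀ i → ι (lookup (digits A m) i) - ι (lookup (digits A m′) i) ≈ (A ⊛ (ι ∘ c)) i) →
      m ≡ m′ × (∀ i → ι (c i) ≈ 0#)
    go []           zero zero c eq = ≡.refl , λ ()
    go (cons p r A) m    m′   c eq
      with m₁≡m₁′ , tail≈0 ← go A (proj₂ (remQuot {suc p} (det A) m)) (proj₂ (remQuot {suc p} (det A) m′)) (tail c) (eq ∘ suc)
      = m≡m′ , λ { zero → c₀≈0 ; (suc i) → tail≈0 i }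
      where
      a  = proj₁ (remQuot {suc p} (det A) m)
      a′ = proj₁ (remQuot {suc p} (det A) m′)
      difference : ι (ℤ.+ toℕ a) - ι (ℤ.+ toℕ a′) ≈ ι (ℤ.+ suc p) * ι (c zero)
      difference = trans (eq zero) (trans
        (+-congˡ (sum-zero (λ j → trans (*-congˡ (tail≈0 j)) (zeroʳ (ι (lookup r j))))))
        (+-identityʳ _))
      a≡a′ = multiple-small a a′ (c zero) (ι-injective (trans (ι-minus (ℤ.+ toℕ a) (ℤ.+ toℕ a′))
        (trans difference (sym (ι-* (ℤ.+ suc p) (c zero))))))
      c₀≈0 = *-cancelˡ-0 (ι≉0 p) (trans (sym difference)
        (x≈y⇒x-y≈0 (reflexive (cong (ι ∘ ℤ.+_ ∘ toℕ) a≡a′))))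
      m≡m′ = ≡.trans (≡.sym (Finₚ.combine-remQuot {suc p} (det A) m))
        (≡.trans (≡.cong₂ combine a≡a′ m₁≡m₁′) (Finₚ.combine-remQuot {suc p} (det A) m′))

-- Integer spans and reduction to Hermite normal form.

module HermiteNormalForms (ℝ : CompleteOrderedField) where

  open FieldProperties ℝ
  open TriangularSystems ℝ

  module _ {X : Set} where

    -- The condition of `_∈_` for any finite family of generators: the reduction passes through
    -- tails of bases, which are not bases of lattices in ℝᵈ.
    record IntegerSpan {n : ℕ} (w : Vector (X → R) n) (v : X → R) : Set where
      constructor _,_
      field
        coefficients : Vector ℤ n
        expansion    : v ≋ combination (λ i → ι (coefficients i)) w

    open IntegerSpan public

    span-≋ : ∀ {n} {w : Vector (X → R) n} {u v} → u ≋ v → IntegerSpan w v → IntegerSpan w u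
    span-≋ eq (c , v≋) = c , λ t → trans (eq t) (v≋ t)

    span-0 : ∀ {n} {w : Vector (X → R) n} → IntegerSpan w (λ _ → 0#)
    span-0 {w = w} = (λ _ → ℤ.0ℤ) , λ t → sym (sum-zero (λ k → zeroˡ (w k t)))

    span-+ : ∀ {n} {w : Vector (X → R) n} {u v} → IntegerSpan w u → IntegerSpan w v →
             IntegerSpan w (λ t → u t + v t)
    span-+ {w = w} (c , u≋) (e , v≋) = (λ i → c i ℤ.+ e i) , λ t → trans (+-cong (u≋ t) (v≋ t))
      (trans (sym (∑-distrib-+ (λ i → ι (c i) * w i t) (λ i → ι (e i) * w i t)))
        (sum-cong λ i → trans (sym (distribʳ (w i t) (ι (c i)) (ι (e i)))) (*-congʳ (sym (ι-+ (c i) (e i))))))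

    span-* : ∀ {n} {w : Vector (X → R) n} k {v} → IntegerSpan w v → IntegerSpan w (λ t → ι k * v t)
    span-* {w = w} k (c , v≋) = (λ i → k ℤ.* c i) , λ t → trans (*-congˡ (v≋ t))
      (trans (*-distribˡ-sum (ι k) (λ i → ι (c i) * w i t))
        (sum-cong λ i → trans (sym (*-assoc (ι k) (ι (c i)) (w i t))) (*-congʳ (sym (ι-* k (c i))))))

    span-neg : ∀ {n} {w : Vector (X → R) n} {v} → IntegerSpan w v → IntegerSpan w (λ t → - v t)
    span-neg {v = v} v∈ = span-≋ (λ t → solve 1 (λ v → :- v := con (ℤ.- ℤ.+ 1) :* v) refl (v t)) (span-* (ℤ.- ℤ.+ 1) v∈)

    span-tail : ∀ {n} {w : Vector (X → R) (suc n)} {v} → IntegerSpan (tail w) v → IntegerSpan w v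
    span-tail {w = w} (c , v≋) = (ℤ.0ℤ V.∷ c) , λ t → trans (v≋ t)
      (sym (trans (+-congʳ (zeroˡ (w zero t))) (+-identityˡ _)))

    span-generator : ∀ {n} (w : Vector (X → R) n) i → IntegerSpan w (w i)
    span-generator w zero    = (ℤ.+ 1 V.∷ λ _ → ℤ.0ℤ) , λ t → sym (trans
      (+-cong (trans (*-congʳ ι-1) (*-identityˡ _)) (sum-zero (λ k → zeroˡ (w (suc k) t)))) (+-identityʳ _))
    span-generator w (suc i) = span-tail {w = w} (span-generator (tail w) i)

    span-⊆ : ∀ {m n} {w : Vector (X → R) m} {z : Vector (X → R) n} {v} →
             (∀ i → IntegerSpan w (z i)) → IntegerSpan z v → IntegerSpan w v
    span-⊆ {n = zero}  z∈ (c , v≋) = span-≋ v≋ span-0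
    span-⊆ {n = suc n} {z = z} z∈ (c , v≋) = span-≋ v≋
      (span-+ (span-* (c zero) (z∈ zero)) (span-⊆ (z∈ ∘ suc) (tail c , λ _ → refl)))

    infix 4 _≃_
    _≃_ : ∀ {m n} → Vector (X → R) m → Vector (X → R) n → Set
    w ≃ z = (∀ i → IntegerSpan w (z i)) × (∀ i → IntegerSpan z (w i))

    ≃-trans : ∀ {l m n} {u : Vector (X → R) l} {v : Vector (X → R) m} {w : Vector (X → R) n} →
              u ≃ v → v ≃ w → u ≃ w
    ≃-trans (u⊇v , v⊇u) (v⊇w , w⊇v) = (λ i → span-⊆ u⊇v (v⊇w i)) , (λ i → span-⊆ w⊇v (v⊇u i))

    ≃-pointwise : ∀ {n} {w z : Vector (X → R) n} → (∀ i → w i ≋ z i) → w ≃ z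
    ≃-pointwise {w = w} {z} eq = (λ i → span-≋ (λ t → sym (eq i t)) (span-generator w i)) ,
                                 (λ i → span-≋ (eq i) (span-generator z i))

    ≃-∷ : ∀ {m n} (x : X → R) {w : Vector (X → R) m} {z : Vector (X → R) n} → w ≃ z → x V.∷ w ≃ x V.∷ z
    ≃-∷ x {w} {z} (w⊇z , z⊇w) =
      (λ { zero → span-generator (x V.∷ w) zero ; (suc i) → span-tail {w = x V.∷ w} (w⊇z i) }) ,
      (λ { zero → span-generator (x V.∷ z) zero ; (suc i) → span-tail {w = x V.∷ z} (z⊇w i) })

    ≃-head-tail : ∀ {n} (w : Vector (X → R) (suc n)) → w ≃ w zero V.∷ tail w
    ≃-head-tail w = ≃-pointwise λ { zero t → refl ; (suc i) t → refl }

    -- Euclid's algorithm on `g` and `h`, performed on generators: with g = r + q h, the pair x, y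
    -- becomes y + q x, x, which has the same span, and the combination becomes h (y + q x) + r x.
    -- The fuel `k` bounds the absolute value of `h`.
    euclid : ∀ k {n} (x y : X → R) (w : Vector (X → R) n) g h → ℤ.∣ h ∣ ℕ.≤ k →
      ∃[ x′ ] ∃[ y′ ] ∃[ g′ ] (x V.∷ y V.∷ w ≃ x′ V.∷ y′ V.∷ w ×
        (∀ t → ι g * x t + ι h * y t ≈ ι g′ * x′ t))
    euclid k x y w g h h≤k with h ℤ.≟ ℤ.0ℤ
    euclid k x y w g h h≤k | yes ≡.refl = x , y , g , ≃-pointwise (λ i t → refl) ,
      λ t → trans (+-congˡ (zeroˡ (y t))) (+-identityʳ _)
    euclid zero x y w g h h≤k | no h≢0 = contradiction (ℤₚ.∣i∣≡0⇒i≡0 (ℕₚ.n≤0⇒n≡0 h≤k)) h≢0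
    euclid (suc k) x y w g h h≤k | no h≢0 =
      let x′ , y′ , g′ , same , eq = euclid k z x w h (ℤ.+ r) (ℕₚ.≤-pred (ℕₚ.<-≤-trans (ℤDivMod.n%d<d g h) h≤k))
      in  x′ , y′ , g′ , ≃-trans exchange same , λ t → trans (division t) (eq t)
      where
      instance _ = ℤ.≢-nonZero h≢0
      q = g ℤDivMod./ h
      r = g ℤDivMod.% h
      z = λ t → y t + ι q * x t
      exchange : x V.∷ y V.∷ w ≃ z V.∷ x V.∷ w
      exchange =
        (λ { zero → span-+ (span-generator (x V.∷ y V.∷ w) (suc zero)) (span-* q (span-generator (x V.∷ y V.∷ w) zero))
           ; (suc zero) → span-generator (x V.∷ y V.∷ w) zero
           ; (suc (suc i)) → span-generator (x V.∷ y V.∷ w) (suc (suc i)) }) ,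
        (λ { zero → span-generator (z V.∷ x V.∷ w) (suc zero)
           ; (suc zero) → span-≋ (λ t → solve 3 (λ x y q → y := y :+ q :* x :+ :- (q :* x)) refl (x t) (y t) (ι q))
               (span-+ (span-generator (z V.∷ x V.∷ w) zero) (span-neg (span-* q (span-generator (z V.∷ x V.∷ w) (suc zero)))))
           ; (suc (suc i)) → span-generator (z V.∷ x V.∷ w) (suc (suc i)) })
      division : ∀ t → ι g * x t + ι h * y t ≈ ι h * z t + ι (ℤ.+ r) * x t
      division t = begin
        ι g * x t + ι h * y t
          ≈⟨ +-congʳ (*-congʳ (trans (reflexive (cong ι (ℤDivMod.a≡a%n+[a/n]*n g h)))
               (trans (ι-+ (ℤ.+ r) (q ℤ.* h)) (+-congˡ (ι-* q h))))) ⟩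
        (ι (ℤ.+ r) + ι q * ι h) * x t + ι h * y t
          ≈⟨ solve 5 (λ r q h x y → (r :+ q :* h) :* x :+ h :* y := h :* (y :+ q :* x) :+ r :* x) refl
               (ι (ℤ.+ r)) (ι q) (ι h) (x t) (y t) ⟩
        ι h * z t + ι (ℤ.+ r) * x t ∎

    -- Euclid's algorithm folded over the coefficients of `v`: in effect `g` is their greatest
    -- common divisor, up to sign.
    multiple-of-generator : ∀ {n} (w : Vector (X → R) (suc n)) {v} → IntegerSpan w v →
      Σ[ z ∈ Vector (X → R) (suc n) ] ∃[ g ] (w ≃ z × (∀ t → v t ≈ ι g * z zero t))
    multiple-of-generator {zero}  w (c , v≋) = w , c zero , ≃-pointwise (λ i t → refl) ,
      λ t → trans (v≋ t) (+-identityʳ _)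
    multiple-of-generator {suc n} w {v} (c , v≋)
      with z , h , same , eq ← multiple-of-generator (tail w) (tail c , λ _ → refl)
      with x′ , y′ , g , same′ , eq′ ← euclid ℤ.∣ h ∣ (w zero) (z zero) (tail z) (c zero) h ℕₚ.≤-refl
      = (x′ V.∷ y′ V.∷ tail z) , g ,
        ≃-trans (≃-head-tail w) (≃-trans (≃-∷ (w zero) (≃-trans same (≃-head-tail z))) same′) ,
        λ t → trans (v≋ t) (trans (+-congˡ (eq t)) (eq′ t))

    positive-multiple : ∀ {n} (w : Vector (X → R) (suc n)) {v} → IntegerSpan w v → ¬ (∀ t → v t ≈ 0#) →
      Σ[ z ∈ Vector (X → R) (suc n) ] ∃[ p ] (w ≃ z × (∀ t → v t ≈ ι (ℤ.+ suc p) * z zero t))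
    positive-multiple w v∈ v≉0 with multiple-of-generator w v∈
    ... | z , ℤ.+ zero  , same , eq = contradiction (λ t → trans (eq t) (zeroˡ (z zero t))) v≉0
    ... | z , ℤ.+ suc p , same , eq = z , p , same , eq
    ... | z , -[1+ p ]  , same , eq = (z₀ V.∷ tail z) , p , ≃-trans same flip ,
      λ t → trans (eq t) (solve 2 (λ q z → :- q :* z := q :* :- z) refl (ι (ℤ.+ suc p)) (z zero t))
      where
      z₀ = λ t → - z zero t
      flip : z ≃ z₀ V.∷ tail z
      flip = (λ { zero → span-neg (span-generator z zero) ; (suc i) → span-generator z (suc i) }) ,
             (λ { zero → span-≋ (λ t → sym (-‿involutive _)) (span-neg (span-generator (z₀ V.∷ tail z) zero))
                ; (suc i) → span-generator (z₀ V.∷ tail z) (suc i) })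

    Independent : ∀ {n} → Vector (X → R) n → Set
    Independent b = ∀ c → (∀ t → combination c b t ≈ 0#) → ∀ i → c i ≈ 0#

    -- Since `A` is upper triangular, `b j` involves only the basis vectors up to `j`; in particular
    -- the last basis vector occurs in the last `b j` alone.
    record Hermite {d} (w b : Vector (X → R) d) : Set where
      field
        basis    : Vector (X → R) d
        A        : Triangular d
        reduced  : Reduced A
        same     : w ≃ basis
        factors  : ∀ j t → b j t ≈ (A ▷ (λ i → basis i t)) j

    -- Choose generators `z` with `b zero` a positive multiple of `z zero`. The coefficients of
    -- `z zero` in the other `b j` form the first row, and the remainders `b⁻` are treated
    -- recursively inside the span of `tail z`.
    hermite : ∀ {d} (w b : Vector (X → R) d) → (∀ j → IntegerSpan w (b j)) → Independent b → Hermite w b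
    hermite {zero}  w b b∈ indep = record
      { basis = w ; A = [] ; reduced = [] ; same = (λ ()) , (λ ()) ; factors = λ () }
    hermite {suc d} w b b∈ indep
      with z , p , same , b₀≋ ← positive-multiple w (b∈ zero) (λ b₀≈0 →
        0≉1 (sym (indep (1# V.∷ λ _ → 0#) (λ t → trans
          (+-cong (trans (*-identityˡ _) (b₀≈0 t)) (sum-zero (λ k → zeroˡ (b (suc k) t)))) (+-identityˡ 0#)) zero)))
      = record
        { basis   = z′
        ; A       = cons p (digits A m) A
        ; reduced = cons p m reduced
        ; same    = ≃-trans same (≃-trans (≃-head-tail z) (≃-trans (≃-∷ (z zero) (Hermite.same H)) shear))
        ; factors = λ { zero t → b₀≋ t ; (suc j) t → factors′ j t }
        }
      where
      b∈z : ∀ j → IntegerSpan z (b (suc j))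
      b∈z j = span-⊆ (proj₂ same) (b∈ (suc j))
      r : Vector ℤ d
      r j = coefficients (b∈z j) zero
      b⁻ : Vector (X → R) d
      b⁻ j = combination (λ i → ι (coefficients (b∈z j) (suc i))) (tail z)
      q = ι (ℤ.+ suc p)
      indep⁻ : Independent b⁻
      indep⁻ c c⊥ i = *-cancelˡ-0 (ι≉0 p) (indep (- s V.∷ λ j → q * c j) relation (suc i))
        where
        s = sum (λ j → c j * ι (r j))
        -- A relation `c` among the `b⁻ j` makes the sum of the `c j * b (suc j)` equal to
        -- `s * z zero`. Multiplied by `q` this is `s * b zero`, a relation among the `b j`.
        relation : ∀ t → - s * b zero t + sum (λ j → q * c j * b (suc j) t) ≈ 0#
        relation t = begin
          - s * b zero t + sum (λ j → q * c j * b (suc j) t)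
            ≈⟨ +-cong (*-congˡ (b₀≋ t)) (trans
                 (sum-cong (λ j → trans (*-congˡ {q * c j} (expansion (b∈z j) t))
                   (solve 5 (λ q c r z b → q :* c :* (r :* z :+ b) := q :* (c :* r :* z :+ c :* b)) refl
                     q (c j) (ι (r j)) (z zero t) (b⁻ j t))))
                 (trans (sym (*-distribˡ-sum q (λ j → c j * ι (r j) * z zero t + c j * b⁻ j t)))
                   (*-congˡ (trans (∑-distrib-+ (λ j → c j * ι (r j) * z zero t) (λ j → c j * b⁻ j t))
                     (+-cong (sym (*-distribʳ-sum (z zero t) (λ j → c j * ι (r j)))) (c⊥ t)))))) ⟩
          - s * (q * z zero t) + q * (s * z zero t + 0#)
            ≈⟨ solve 3 (λ s q z → :- s :* (q :* z) :+ q :* (s :* z :+ con (ℤ.+ 0)) := con (ℤ.+ 0)) refl s q (z zero t) ⟩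
          0# ∎
      H = hermite (tail z) b⁻ (λ j → (λ i → coefficients (b∈z j) (suc i)) , λ t → refl) indep⁻
      open Hermite H using (basis; A; reduced; factors)
      residue = reduceᵀ A r
      m = proj₁ residue
      τ = proj₁ (proj₂ residue)
      -- Adding `τ i * z zero` to the basis vectors subtracts `A ▷ τ` from the first row, and
      -- `reduceᵀ` chose `τ` so that the digits of `m` are left.
      z′ = z zero V.∷ λ i t → basis i t + ι (τ i) * z zero t
      shear : z zero V.∷ basis ≃ z′
      shear =
        (λ { zero → span-generator (z zero V.∷ basis) zero
           ; (suc i) → span-+ (span-generator (z zero V.∷ basis) (suc i)) (span-* (τ i) (span-generator (z zero V.∷ basis) zero)) }) ,
        (λ { zero → span-generator z′ zero
           ; (suc i) → span-≋ (λ t → solve 2 (λ x y → x := x :+ y :+ :- y) refl (basis i t) (ι (τ i) * z zero t))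
               (span-+ (span-generator z′ (suc i)) (span-neg (span-* (τ i) (span-generator z′ zero)))) })
      factors′ : ∀ j t → b (suc j) t ≈ ι (lookup (digits A m) j) * z zero t + (A ▷ (λ i → z′ (suc i) t)) j
      factors′ j t = begin
        b (suc j) t
          ≈⟨ expansion (b∈z j) t ⟩
        ι (r j) * z zero t + b⁻ j t
          ≈⟨ +-cong (*-congʳ (proj₂ (proj₂ residue) j)) (factors j t) ⟩
        (ι (lookup (digits A m) j) + (A ▷ (λ i → ι (τ i))) j) * z zero t + (A ▷ (λ i → basis i t)) j
          ≈⟨ solve 4 (λ x a z b → (x :+ a) :* z :+ b := x :* z :+ (b :+ a :* z)) refl
               (ι (lookup (digits A m) j)) ((A ▷ (λ i → ι (τ i))) j) (z zero t) ((A ▷ (λ i → basis i t)) j) ⟩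
        ι (lookup (digits A m) j) * z zero t + ((A ▷ (λ i → basis i t)) j + (A ▷ (λ i → ι (τ i))) j * z zero t)
          ≈⟨ +-congˡ (▷-shear A (λ i → basis i t) (λ i → ι (τ i)) (z zero t) j) ⟨
        ι (lookup (digits A m) j) * z zero t + (A ▷ (λ i → z′ (suc i) t)) j ∎

-- Sublattices spanned by minimal vectors, and exchange at maximal index.

-- The last diagonal entry is suc (lastDiagonal A).
lastDiagonal : ∀ {d} → Triangular (suc d) → ℕ
lastDiagonal {zero}  (cons p r A) = p
lastDiagonal {suc d} (cons p r A) = lastDiagonal A

-- The last column becomes `y`, except that its diagonal entry is given by `p′`, the representation
-- that keeps it positive.
replaceLast : ∀ {d} → Triangular (suc d) → ℕ → Vector ℤ (suc d) → Triangular (suc d)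
replaceLast {zero}  (cons p r A) p′ y = cons p′ r A
replaceLast {suc d} (cons p r A) p′ y = cons p (r [ fromℕ d ]≔ y zero) (replaceLast A p′ (tail y))

det-replaceLast : ∀ {d} (A : Triangular (suc d)) {p′} y → lastDiagonal A ℕ.< p′ →
                  det A ℕ.< det (replaceLast A p′ y)
det-replaceLast {zero}  (cons p r []) y p<p′ = ℕₚ.*-monoˡ-< 1 (ℕ.s≤s p<p′)
det-replaceLast {suc d} (cons p r A)  y p<p′ = ℕₚ.*-monoʳ-< (suc p) (det-replaceLast A (tail y) p<p′)

transpose-left : ∀ {n} (i j : Fin n) → transpose i j j ≡ i
transpose-left i j with j Finₚ.≟ i
... | yes j≡i = j≡i
... | no  _   with j Finₚ.≟ j
...   | yes _   = ≡.refl
...   | no  j≢j = contradiction ≡.refl j≢j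

transpose-injective : ∀ {n} (i j : Fin n) {k l} → transpose i j k ≡ transpose i j l → k ≡ l
transpose-injective i j {k} {l} eq = ≡.trans (≡.sym (transpose-inverse j i))
  (≡.trans (cong (transpose j i) eq) (transpose-inverse j i))

module Lattices (ℝ : CompleteOrderedField) where

  open FieldProperties ℝ
  open DualBases ℝ
  open PerfectForms ℝ
  open TriangularSystems ℝ
  open HermiteNormalForms ℝ

  ⊛-last : ∀ {d} (A : Triangular (suc d)) x →
           (A ⊛ x) (fromℕ d) ≈ ι (ℤ.+ suc (lastDiagonal A)) * x (fromℕ d)
  ⊛-last {zero}  (cons p r A) x = +-identityʳ _
  ⊛-last {suc d} (cons p r A) x = ⊛-last A (tail x)

  replaceLast-▷-≢ : ∀ {d} (A : Triangular (suc d)) p′ y u {j} → fromℕ d ≢ j →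
                    (replaceLast A p′ y ▷ u) j ≈ (A ▷ u) j
  replaceLast-▷-≢ {zero}  (cons p r A) p′ y u {zero}  last≢j = contradiction ≡.refl last≢j
  replaceLast-▷-≢ {suc d} (cons p r A) p′ y u {zero}  last≢j = refl
  replaceLast-▷-≢ {suc d} (cons p r A) p′ y u {suc j} last≢j = +-cong
    (*-congʳ (reflexive (cong ι (Vecₚ.lookup∘update′ (last≢j ∘ cong suc ∘ ≡.sym) r (y zero)))))
    (replaceLast-▷-≢ A p′ (tail y) (tail u) (last≢j ∘ cong suc))

  replaceLast-▷-last : ∀ {d} (A : Triangular (suc d)) p′ y u → y (fromℕ d) ≡ ℤ.+ suc p′ →
                       (replaceLast A p′ y ▷ u) (fromℕ d) ≈ ⟨ (λ i → ι (y i)) , u ⟩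
  replaceLast-▷-last {zero}  (cons p r A) p′ y u eq =
    trans (*-congʳ (reflexive (cong ι (≡.sym eq)))) (sym (+-identityʳ _))
  replaceLast-▷-last {suc d} (cons p r A) p′ y u eq = +-cong
    (*-congʳ (reflexive (cong ι (Vecₚ.lookup∘update (fromℕ d) r (y zero)))))
    (replaceLast-▷-last A p′ (tail y) (tail u) eq)

  biorthogonal⇒independent : ∀ {m n} (ω η : Vector (Vector R n) m) →
    (∀ a b → ⟨ η a , ω b ⟩ ≈ δ a b) → Independent ω
  biorthogonal⇒independent ω η dual c eq a = begin
    c a                                 ≈⟨ sum-δ a c ⟨
    sum (λ k → δ a k * c k)             ≈⟨ sum-cong (λ k → trans (*-comm (δ a k) (c k)) (*-congˡ (sym (dual a k)))) ⟩
    sum (λ k → c k * ⟨ η a , ω k ⟩)     ≈⟨ ⟨⟩-combination (η a) c ω ⟨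
    ⟨ η a , combination c ω ⟩           ≈⟨ sum-zero (λ i → trans (*-congˡ (eq i)) (zeroʳ _)) ⟩
    0#                                  ∎

  combination-minus : ∀ {X : Set} {n} (x y : Vector R n) (w : Vector (X → R) n) t →
    combination (λ i → x i - y i) w t ≈ combination x w t - combination y w t
  combination-minus x y w t = trans
    (sum-cong λ i → solve 3 (λ x y w → (x :- y) :* w := x :* w :- y :* w) refl (x i) (y i) (w i t))
    (sum-minus (λ i → x i * w i t) (λ i → y i * w i t))

  combination-cong : ∀ {X : Set} {n} {x y : Vector R n} (w : Vector (X → R) n) → x ≋ y →
                     combination x w ≋ combination y w
  combination-cong w eq t = sum-cong λ i → *-congʳ (eq i)

  -- The span of `b` has index `det A` in the span of `w`: the points `box m` are incongruent modulo
  -- `b`, and each vector of the larger span is congruent to one of them.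
  module Factored {X : Set} {d} {w b : Vector (X → R) d} (A : Triangular d)
    (factors : ∀ j t → b j t ≈ (A ▷ (λ i → w i t)) j) (indep : Independent b) where

    change : ∀ x t → combination x b t ≈ combination (A ⊛ x) w t
    change x t = trans (sum-cong λ j → *-congˡ (factors j t)) (adjoint A x (λ i → w i t))

    w-independent : Independent w
    w-independent y eq i with x , Ax≋y ← ⊛-surjective A y = begin
      y i               ≈⟨ Ax≋y i ⟨
      (A ⊛ x) i         ≈⟨ ⊛-cong A (λ j → trans (x≈0 j) (sym (x≈y⇒x-y≈0 {x j} refl))) i ⟩
      (A ⊛ (λ j → x j - x j)) i     ≈⟨ ⊛-minus A x x i ⟩
      (A ⊛ x) i - (A ⊛ x) i         ≈⟨ -‿inverseʳ _ ⟩
      0#                ∎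
      where
      x≈0 = indep x λ t → trans (change x t) (trans (combination-cong w Ax≋y t) (eq t))

    w-unique : ∀ x y → combination x w ≋ combination y w → x ≋ y
    w-unique x y eq i = x-y≈0⇒x≈y (w-independent (λ i → x i - y i)
      (λ t → trans (combination-minus x y w t) (x≈y⇒x-y≈0 (eq t))) i)

    box : Fin (det A) → X → R
    box m = combination (λ i → ι (lookup (digits A m) i)) w

    box-incongruent : ∀ m m′ → IntegerSpan b (λ t → box m t - box m′ t) → m ≡ m′
    box-incongruent m m′ (c , eq) = box-injective A m m′ c (w-unique _ _ λ t → begin
      combination (λ i → ι (lookup (digits A m) i) - ι (lookup (digits A m′) i)) w t
        ≈⟨ combination-minus (λ i → ι (lookup (digits A m) i)) (λ i → ι (lookup (digits A m′) i)) w t ⟩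
      box m t - box m′ t                           ≈⟨ eq t ⟩
      combination (λ i → ι (c i)) b t              ≈⟨ change (λ i → ι (c i)) t ⟩
      combination (A ⊛ (λ i → ι (c i))) w t        ∎)

    residue : ∀ {v} → IntegerSpan w v → Fin (det A)
    residue v∈ = proj₁ (reduce A (coefficients v∈))

    quotient : ∀ {v} → IntegerSpan w v → Vector ℤ d
    quotient v∈ = proj₁ (proj₂ (reduce A (coefficients v∈)))

    residue-decomposition : ∀ {v} (v∈ : IntegerSpan w v) t →
      v t ≈ box (residue v∈) t + combination (λ i → ι (quotient v∈ i)) b t
    residue-decomposition {v} v∈ t = begin
      v t   ≈⟨ expansion v∈ t ⟩
      combination (λ i → ι (coefficients v∈ i)) w t
        ≈⟨ combination-cong w (proj₂ (proj₂ (reduce A (coefficients v∈)))) t ⟩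
      combination (λ i → ρ i + (A ⊛ (λ i → ι (quotient v∈ i))) i) w t
        ≈⟨ trans (sum-cong λ i → distribʳ (w i t) (ρ i) ((A ⊛ (λ i → ι (quotient v∈ i))) i))
             (∑-distrib-+ (λ i → ρ i * w i t) (λ i → (A ⊛ (λ i → ι (quotient v∈ i))) i * w i t)) ⟩
      box (residue v∈) t + combination (A ⊛ (λ i → ι (quotient v∈ i))) w t
        ≈⟨ +-congˡ (change (λ i → ι (quotient v∈ i)) t) ⟨
      box (residue v∈) t + combination (λ i → ι (quotient v∈ i)) b t ∎
      where
      ρ = λ i → ι (lookup (digits A (residue v∈)) i)

    residue-difference : ∀ {u v} (u∈ : IntegerSpan w u) (v∈ : IntegerSpan w v) → residue u∈ ≡ residue v∈ →
      ∀ t → u t - v t ≈ combination (λ i → ι (quotient u∈ i ℤ.- quotient v∈ i)) b t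
    residue-difference {u} {v} u∈ v∈ eq t = begin
      u t - v t
        ≈⟨ +-cong (residue-decomposition u∈ t) (-‿cong (residue-decomposition v∈ t)) ⟩
      box (residue u∈) t + p - (box (residue v∈) t + q)
        ≈⟨ +-congʳ (+-congʳ (reflexive (cong (λ m → box m t) eq))) ⟩
      box (residue v∈) t + p - (box (residue v∈) t + q)
        ≈⟨ solve 3 (λ x p q → x :+ p :- (x :+ q) := p :- q) refl (box (residue v∈) t) p q ⟩
      p - q
        ≈⟨ combination-minus (λ i → ι (quotient u∈ i)) (λ i → ι (quotient v∈ i)) b t ⟨
      combination (λ i → ι (quotient u∈ i) - ι (quotient v∈ i)) b t
        ≈⟨ combination-cong b (λ i → ι-minus (quotient u∈ i) (quotient v∈ i)) t ⟨
      combination (λ i → ι (quotient u∈ i ℤ.- quotient v∈ i)) b t ∎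
      where
      p = combination (λ i → ι (quotient u∈ i)) b t
      q = combination (λ i → ι (quotient v∈ i)) b t

  module _ {d} (Λ : Lattice d) where

    open Lattice Λ

    ∈⇒span : ∀ {v} → v ∈ Λ → IntegerSpan basis v
    ∈⇒span (c , eq) = c , eq

    span⇒∈ : ∀ {v} → IntegerSpan basis v → v ∈ Λ
    span⇒∈ (c , eq) = c , eq

    minimal-norms : ∀ {v w} → Minimal Λ v → Minimal Λ w → ⟨ v , v ⟩ ≈ ⟨ w , w ⟩
    minimal-norms (v∈ , v≉0 , v≤) (w∈ , w≉0 , w≤) = antisym (v≤ _ w∈ w≉0) (w≤ _ v∈ v≉0)

    minimal-neg : ∀ {v} → Minimal Λ v → Minimal Λ (λ i → - v i)
    minimal-neg {v} (v∈ , v≉0 , v≤) = span⇒∈ (span-neg (∈⇒span v∈)) ,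
      (λ -v≈0 → v≉0 λ i → trans (sym (-‿involutive (v i))) (trans (-‿cong (-v≈0 i)) -0#≈0#)) ,
      λ w w∈ w≉0 → ≤-respˡ (sum-cong λ i → solve 1 (λ x → x :* x := :- x :* :- x) refl (v i)) (v≤ w w∈ w≉0)

    record Frame : Set where
      field
        {vectors duals} : Vector (Vector R d) d
        isDual  : Dual vectors duals
        minimal : ∀ a → Minimal Λ (vectors a)

      open Dual isDual public

      coordinate : Vector R d → Vector R d
      coordinate x a = ⟨ duals a , x ⟩

      vectors-independent : Independent vectors
      vectors-independent = biorthogonal⇒independent vectors duals dual

      vectors∈ : ∀ a → IntegerSpan basis (vectors a)
      vectors∈ a = ∈⇒span (proj₁ (minimal a))

      sublattice : Lattice d
      sublattice = record { basis = vectors ; independent = vectors-independent }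

    -- A witness that the span of `b` has index at least `n` in the lattice, shaped like the
    -- families that `IndexAtMost` bounds.
    Incongruent : Vector (Vector R d) d → ℕ → Set
    Incongruent b n = Σ[ f ∈ (Fin n → Vector R d) ] ((∀ i → IntegerSpan basis (f i)) ×
      (∀ i j → IntegerSpan b (λ t → f i t - f j t) → i ≡ j))

    incongruent-≤ : ∀ {b m n} → m ℕ.≤ n → Incongruent b n → Incongruent b m
    incongruent-≤ m≤n (f , f∈ , f≢) = (λ i → f (inject≤ i m≤n)) , (λ i → f∈ (inject≤ i m≤n)) ,
      λ i j eq → Finₚ.inject≤-injective m≤n m≤n i j (f≢ _ _ eq)

    incongruent-⊆ : ∀ {b b′ n} → (∀ i → IntegerSpan b (b′ i)) → Incongruent b n → Incongruent b′ n
    incongruent-⊆ b⊇b′ (f , f∈ , f≢) = f , f∈ , λ i j eq → f≢ i j (span-⊆ b⊇b′ eq)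

    module _ {w b : Vector (Vector R d) d} (A : Triangular d) (same : basis ≃ w)
      (factors : ∀ j t → b j t ≈ (A ▷ (λ i → w i t)) j) (indep : Independent b) where

      open Factored A factors indep

      box-family : Incongruent b (det A)
      box-family = box , (λ m → span-⊆ (proj₁ same) ((lookup (digits A m)) , λ t → refl)) , box-incongruent

      index≤det : ∀ {n} → Incongruent b n → n ℕ.≤ det A
      index≤det (f , f∈ , f≢) = Finₚ.injective⇒≤ λ {i} {j} eq →
        f≢ i j ((λ k → quotient (f∈w i) k ℤ.- quotient (f∈w j) k) , residue-difference (f∈w i) (f∈w j) eq)
        where
        f∈w = λ i → span-⊆ (proj₂ same) (f∈ i)

  -- The frame vectors stay minimal in the sublattice, which is therefore well-rounded. Its other
  -- minimal vectors are no longer than `vectors zero`, which exists in positive dimension, so they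
  -- are minimal in `Λ` too.
  index-bound : ∀ {d I} → BoundsIndices (suc d) I → (Λ : Lattice (suc d)) (F : Frame Λ) →
    ∀ {n} → Incongruent Λ (Frame.vectors F) n → n ℕ.≤ I
  index-bound bounds Λ F {n} (f , f∈ , f≢) =
    bounds Λ Λ′ sub rounded minimal⇒minimal n f (λ i → span⇒∈ Λ (f∈ i))
      λ i j eq → f≢ i j (∈⇒span Λ′ eq)
    where
    open Frame F
    Λ′ = sublattice
    sub : Λ′ ⊆ Λ
    sub v v∈ = span⇒∈ Λ (span-⊆ vectors∈ (∈⇒span Λ′ v∈))
    vectors-minimal : ∀ a → Minimal Λ′ (vectors a)
    vectors-minimal a = span⇒∈ Λ′ (span-generator vectors a) , proj₁ (proj₂ (minimal a)) ,
      λ w w∈ → proj₂ (proj₂ (minimal a)) w (sub w w∈)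
    rounded : WellRounded Λ′
    rounded x = _ , coordinate x , vectors , vectors-minimal , expand x
    minimal⇒minimal : ∀ v → Minimal Λ′ v → Minimal Λ v
    minimal⇒minimal v (v∈ , v≉0 , v≤) = sub v v∈ , v≉0 , λ w w∈ w≉0 → ≤-trans
      (v≤ (vectors zero) (proj₁ (vectors-minimal zero)) (proj₁ (proj₂ (minimal zero))))
      (proj₂ (proj₂ (minimal zero)) w w∈ w≉0)

  -- The index is at least `n`, not exactly `n`; maximality is the failure at the next number.
  FrameOfIndex : ∀ {d} → Lattice d → ℕ → Set
  FrameOfIndex Λ n = Σ[ F ∈ Frame Λ ] Incongruent Λ (Frame.vectors F) n

  larger-diagonal : ∀ {k i} → ℤ.+ suc k ℤ.< i → ∃[ p ] (i ≡ ℤ.+ suc p × k ℕ.< p)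
  larger-diagonal {i = ℤ.+ suc p} (ℤ.+<+ (ℕ.s≤s k<p)) = p , ≡.refl , k<p

  q<qx : ∀ {q x} → 0# < q → 1# < x → q < q * x
  q<qx {q} {x} 0<q 1<x qx≤q = 1<x (≤-reflexive (*-cancelˡ (λ q≈0 → 0<q (≤-reflexive q≈0))
    (antisym (≤-respʳ (sym (*-identityʳ q)) qx≤q)
      (≤-via (solve 3 (λ q x o → q :* x :- q :* o := q :* (x :- o) :- con (ℤ.+ 0)) refl q x 1#)
        (*-nonNegative (<⇒≤ 0<q) (x≤y⇒0≤y-x (<⇒≤ 1<x)))))))

  module _ {d} (Λ : Lattice (suc d)) where

    -- In the Hermite basis of b only the last column of A changes, so that the
    -- determinant, which is the index, grows with the last diagonal entry.
    last-exchange : ∀ {b b′ : Vector (Vector R (suc d)) (suc d)} → Independent b → Independent b′ →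
      Hermite (Lattice.basis Λ) b → ∀ {v x} → v ∈ Λ → v ≋ combination x b → 1# < x (fromℕ d) →
      (∀ t → b′ (fromℕ d) t ≈ v t) → (∀ {j} → fromℕ d ≢ j → ∀ t → b′ j t ≈ b j t) →
      ∀ {n} → Incongruent Λ b n → Incongruent Λ b′ (suc n)
    last-exchange {b} {b′} indep indep′ H {v} {x} v∈ v≋ 1<x b′-last b′-≢ family =
      incongruent-≤ Λ (ℕₚ.≤-<-trans (index≤det Λ A same factors indep family) (det-replaceLast A y A<p))
        (box-family Λ (replaceLast A p y) same factors′ indep′)
      where
      open Hermite H
      open Factored A factors indep
      last = fromℕ d
      v∈w : IntegerSpan basis v
      v∈w = span-⊆ (proj₂ same) (∈⇒span Λ v∈)
      y = coefficients v∈w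
      q = ι (ℤ.+ suc (lastDiagonal A))
      -- The last row of `A` has a single nonzero entry, so the last coordinate of `v` in the
      -- Hermite basis is that diagonal entry times `x last`. As `x last` exceeds 1, this integer is
      -- larger than the entry it replaces.
      y-last : ι (y last) ≈ q * x last
      y-last = begin
        ι (y last)         ≈⟨ w-unique (λ i → ι (y i)) (A ⊛ x) (λ t → trans (sym (expansion v∈w t)) (trans (v≋ t) (change x t))) last ⟩
        (A ⊛ x) last       ≈⟨ ⊛-last A x ⟩
        q * x last         ∎
      diagonal = larger-diagonal (ι-cancel-< {ℤ.+ suc (lastDiagonal A)} {y last}
        λ ≤q → q<qx {q} {x last} (0<1+n (lastDiagonal A)) 1<x (≤-respˡ {q} y-last ≤q))
      p = proj₁ diagonal
      A<p = proj₂ (proj₂ diagonal)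
      factors′ : ∀ j t → b′ j t ≈ (replaceLast A p y ▷ (λ i → basis i t)) j
      factors′ j t = split (last Finₚ.≟ j)
        where
        split : Dec (last ≡ j) → b′ j t ≈ (replaceLast A p y ▷ (λ i → basis i t)) j
        split (yes ≡.refl) = trans (b′-last t) (trans (expansion v∈w t)
          (sym (replaceLast-▷-last A p y (λ i → basis i t) (proj₁ (proj₂ diagonal)))))
        split (no last≢j) = trans (b′-≢ last≢j t) (trans (factors j t)
          (sym (replaceLast-▷-≢ A p y (λ i → basis i t) last≢j)))

    -- The place `a` is moved to the end by a transposition, where `last-exchange` applies;
    -- incongruence depends only on the span, so families survive the permutation in both
    -- directions.
    exchange : (F : Frame Λ) → ∀ {n} → Incongruent Λ (Frame.vectors F) n →
      ∀ {v} → Minimal Λ v → ∀ a → 1# < Frame.coordinate F v a → FrameOfIndex Λ (suc n)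
    exchange F {n} family {v} v-min a 1<ξ = F′ , incongruent-⊆ Λ
        (λ i → span-≋ (λ t → reflexive (cong (λ j → b′ j t) (≡.sym (transpose-inverse a last)))) (span-generator (b′ ∘ π) (transpose last a i)))
        (last-exchange indep-π indep′ (hermite (Lattice.basis Λ) (vectors ∘ π) (vectors∈ ∘ π) indep-π) {v} {ξ ∘ π}
          (proj₁ v-min) (λ t → trans (expand v t) (sum-permute (λ k → ξ k * vectors k t) (Permutation.transpose a last)))
          (λ ξ≤1 → 1<ξ (≤-respˡ (reflexive (cong ξ π-last)) ξ≤1))
          (λ t → reflexive (cong (λ u → u t) (≡.trans (cong b′ π-last) (replace-≡ a v vectors))))
          (λ last≢j t → reflexive (cong (λ u → u t) (replace-≢ v vectors
            (λ a≡πj → last≢j (transpose-injective a last (≡.trans π-last a≡πj))))))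
          (incongruent-⊆ Λ (λ i → span-generator vectors (π i)) family))
      where
      open Frame F
      last = fromℕ d
      π = transpose a last
      π-last : π last ≡ a
      π-last = transpose-left a last
      ξ = coordinate v
      b′ = replace a v vectors
      F′ : Frame Λ
      F′ = record
        { isDual  = Pivot.pivot isDual a v (λ ξ≈0 → 1<ξ (≤-respˡ (sym ξ≈0) 0≤1))
        ; minimal = replace-All {P = Minimal Λ} a v-min minimal }
      δ-π : ∀ i j → δ (π i) (π j) ≈ δ i j
      δ-π i j with i Finₚ.≟ j
      ... | yes ≡.refl = trans (δ-refl (π i)) (sym (δ-refl i))
      ... | no  i≢j    = trans (δ-≢ (i≢j ∘ transpose-injective a last)) (sym (δ-≢ i≢j))
      indep-π : Independent (vectors ∘ π)
      indep-π = biorthogonal⇒independent (vectors ∘ π) (duals ∘ π) λ i j → trans (dual (π i) (π j)) (δ-π i j)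
      indep′ : Independent (b′ ∘ π)
      indep′ = biorthogonal⇒independent (b′ ∘ π) (Frame.duals F′ ∘ π) λ i j → trans (Frame.dual F′ (π i) (π j)) (δ-π i j)

  Extremal : ∀ {d} {Λ : Lattice d} → Frame Λ → Set
  Extremal {Λ = Λ} F = ∀ v → Minimal Λ v → ∀ a → - 1# ≤ Frame.coordinate F v a × Frame.coordinate F v a ≤ 1#

  extremal-frame : ∀ {d I} → BoundsIndices (suc d) I → (Λ : Lattice (suc d)) → Perfect Λ →
                   ¬ ¬ (Σ[ F ∈ Frame Λ ] Extremal F)
  extremal-frame bounds Λ perfect k =
    separating⇒dual (minimal-separating {Λ = Λ} perfect) λ (ω , η , D , min) →
    -- The empty family starts the search: any frame at all has index at least 0.
    ¬¬-maximum {FrameOfIndex Λ} (record { isDual = D ; minimal = min } , (λ ()) , (λ ()) , λ ())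
      (λ n (F , family) → index-bound bounds Λ F family)
      λ (n , (F , family) , best) →
        let bounded : ∀ v → Minimal Λ v → ∀ a → Frame.coordinate F v a ≤ 1#
            bounded v v-min a = decidable-stable (_ ≤? 1#) λ 1<ξ →
              best (exchange Λ F family v-min a 1<ξ)
        in k (F , λ v v-min a →
          -- The lower bound for `v` is the upper bound for the minimal vector `- v`.
          ≤-via (begin
            Frame.coordinate F v a - - 1#      ≈⟨ solve 2 (λ x o → x :- :- o := o :- :- x) refl _ 1# ⟩
            1# - - Frame.coordinate F v a      ≈⟨ +-congˡ (-‿cong (⟨⟩-negʳ (Frame.duals F a) v)) ⟨
            1# - Frame.coordinate F (λ i → - v i) a  ∎)
            (bounded (λ i → - v i) (minimal-neg Λ v-min) a) ,
          bounded v v-min a)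

-- Codes of minimal vectors.

funToFin-injective : ∀ {m n} (f g : Fin m → Fin n) → funToFin f ≡ funToFin g → ∀ i → f i ≡ g i
funToFin-injective f g eq i = ≡.trans (≡.sym (Finₚ.finToFun-funToFin f i))
  (≡.trans (cong (λ k → finToFun k i) eq) (Finₚ.finToFun-funToFin g i))

module Counting (ℝ : CompleteOrderedField) where

  open FieldProperties ℝ
  open DualBases ℝ
  open PerfectForms ℝ
  open TriangularSystems ℝ
  open HermiteNormalForms ℝ
  open Lattices ℝ

  -- The floor of x ∈ [-1, 1], shifted by 1.
  trit : R → Fin 3
  trit x with 0# ≤? x
  ... | no  _ = zero
  ... | yes _ with 1# ≤? x
  ...   | no  _ = suc zero
  ...   | yes _ = suc (suc zero)

  Bounded : R → Set
  Bounded x = - 1# ≤ x × x ≤ 1#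

  -- The classes of `trit` in [-1, 1] are [-1, 0), [0, 1) and the single point 1; none contains two
  -- points at distance 1 or more.
  trit-close : ∀ {x y} → Bounded x → Bounded y → trit x ≡ trit y → x - y < 1#
  trit-close {x} {y} (-1≤x , x≤1) (-1≤y , y≤1) eq 1≤x-y with 0# ≤? x | 0# ≤? y
  ... | no  0≰x | no  _ = 0≰x (≤-trans
    (≤-via (solve 2 (λ y o → (o :+ y) :- con (ℤ.+ 0) := y :- :- o) refl y 1#) -1≤y)
    (≤-via (solve 3 (λ x y o → x :- (o :+ y) := (x :- y) :- o) refl x y 1#) 1≤x-y))
  ... | no  0≰x | yes 0≤y with 1# ≤? y
  trit-close _ _ () _ | no _ | yes _ | no _
  trit-close _ _ () _ | no _ | yes _ | yes _
  trit-close {x} {y} (-1≤x , x≤1) (-1≤y , y≤1) eq 1≤x-y | yes _ | no _ with 1# ≤? x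
  trit-close _ _ () _ | yes _ | no _ | no _
  trit-close _ _ () _ | yes _ | no _ | yes _
  trit-close {x} {y} (-1≤x , x≤1) (-1≤y , y≤1) eq 1≤x-y | yes _ | yes 0≤y with 1# ≤? x | 1# ≤? y
  ... | no 1≰x | no  _   = 1≰x (≤-trans 1≤x-y (≤-via (solve 2 (λ x y → x :- (x :- y) := y :- con (ℤ.+ 0)) refl x y) 0≤y))
  ... | yes _  | yes 1≤y = 0<1 (≤-trans 1≤x-y (≤-via (solve 2 (λ x y → con (ℤ.+ 0) :- (x :- y) := y :- x) refl x y) (≤-trans x≤1 1≤y)))

  ι<1⇒≤0 : ∀ k → ι k < 1# → k ℤ.≤ ℤ.0ℤ
  ι<1⇒≤0 k k<1 with k ℤ.≤? ℤ.0ℤ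
  ... | yes k≤0 = k≤0
  ... | no  k≰0 = contradiction (≤-respˡ ι-1 (ι-mono (ℤₚ.i<j⇒suc[i]≤j (ℤₚ.≰⇒> k≰0)))) k<1

  integral-difference : ∀ {x y} k → Bounded x → Bounded y → trit x ≡ trit y → x - y ≈ ι k → x ≈ y
  integral-difference {x} {y} k bx by eq x-y≈k = x-y≈0⇒x≈y (trans x-y≈k (reflexive (cong ι k≡0)))
    where
    -k≈ : ι (ℤ.- k) ≈ y - x
    -k≈ = trans (ι-neg k) (trans (-‿cong (sym x-y≈k)) (solve 2 (λ x y → :- (x :- y) := y :- x) refl x y))
    k≤0 = ι<1⇒≤0 k λ 1≤k → trit-close bx by eq (≤-respʳ (sym x-y≈k) 1≤k)
    -k≤0 = ι<1⇒≤0 (ℤ.- k) λ 1≤-k → trit-close by bx (≡.sym eq) (≤-respʳ -k≈ 1≤-k)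
    k≡0 : k ≡ ℤ.0ℤ
    k≡0 = ℤₚ.≤-antisym k≤0 (≡.subst (ℤ.0ℤ ℤ.≤_) (ℤₚ.neg-involutive k) (ℤₚ.neg-mono-≤ -k≤0))

  -- The matrix `A` is a parameter, so that two lattices with equal matrices can be made to share it
  -- by matching on the equality.
  record Factorisation {d} (Λ : Lattice d) (b : Vector (Vector R d) d) (A : Triangular d) : Set where
    field
      {basis}     : Vector (Vector R d) d
      same        : Lattice.basis Λ ≃ basis
      factors     : ∀ j t → b j t ≈ (A ▷ (λ i → basis i t)) j
      independent : Independent b

    open Factored A factors independent public

    ∈basis : ∀ {v} → v ∈ Λ → IntegerSpan basis v
    ∈basis v∈ = span-⊆ (proj₂ same) (∈⇒span Λ v∈)

    -- Up to an integer vector, the coordinates `x` of `v` in `b` solve a system given by `A` and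
    -- the residue alone. This allows a comparison of vectors from different lattices.
    coordinates-residue : ∀ {v x} (v∈ : IntegerSpan basis v) → v ≋ combination x b →
      A ⊛ (λ i → x i - ι (quotient v∈ i)) ≋ (λ i → ι (lookup (digits A (residue v∈)) i))
    coordinates-residue {v} {x} v∈ v≋ i = begin
      (A ⊛ (λ i → x i - t i)) i         ≈⟨ ⊛-minus A x t i ⟩
      (A ⊛ x) i - (A ⊛ t) i             ≈⟨ +-congʳ (trans
        (sym (w-unique (λ i → ι (coefficients v∈ i)) (A ⊛ x) (λ s → trans (sym (expansion v∈ s)) (trans (v≋ s) (change x s))) i))
        (proj₂ (proj₂ (reduce A (coefficients v∈))) i)) ⟩
      ι (lookup (digits A (residue v∈)) i) + (A ⊛ t) i - (A ⊛ t) i   ≈⟨ solve 2 (λ r s → r :+ s :- s := r) refl _ ((A ⊛ t) i) ⟩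
      ι (lookup (digits A (residue v∈)) i) ∎
      where
      t : Vector R _
      t i = ι (quotient v∈ i)

  module _ {d I : ℕ} where

    vectorCode : ∀ {Λ : Lattice d} {b A} (Fc : Factorisation Λ b A) → det A ℕ.≤ I →
                 ∀ {v} → v ∈ Λ → Vector R d → Fin (3 ℕ.^ d ℕ.* I)
    vectorCode Fc det≤I v∈ x = combine (funToFin (trit ∘ x))
      (inject≤ (Factorisation.residue Fc (Factorisation.∈basis Fc v∈)) det≤I)

    -- Equal residues make the coordinates differ by integers, and equal trits leave only the
    -- difference 0.
    vectorCode-injective : ∀ {Λ Λ′ : Lattice d} {b b′ A A′} → A ≡ A′ →
      (Fc : Factorisation Λ b A) (Fc′ : Factorisation Λ′ b′ A′) → ∀ det≤I det≤I′ {v v′ x x′} (v∈ : v ∈ Λ) (v′∈ : v′ ∈ Λ′) →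
      v ≋ combination x b → v′ ≋ combination x′ b′ → (∀ i → Bounded (x i)) → (∀ i → Bounded (x′ i)) →
      vectorCode Fc det≤I v∈ x ≡ vectorCode Fc′ det≤I′ v′∈ x′ → x ≋ x′
    vectorCode-injective {A = A} ≡.refl Fc Fc′ det≤I det≤I′ {v} {v′} {x} {x′} v∈ v′∈ v≋ v′≋ bx bx′ eq i =
      integral-difference (t i ℤ.- t′ i) (bx i) (bx′ i) (funToFin-injective (trit ∘ x) (trit ∘ x′) (proj₁ codes) i) (begin
        x i - x′ i
          ≈⟨ solve 4 (λ x y s t → x :- y := x :- s :- (y :- t) :+ (s :- t)) refl (x i) (x′ i) (ι (t i)) (ι (t′ i)) ⟩
        x i - ι (t i) - (x′ i - ι (t′ i)) + (ι (t i) - ι (t′ i))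
          ≈⟨ +-cong (x≈y⇒x-y≈0 (fractional i)) (sym (ι-minus (t i) (t′ i))) ⟩
        0# + ι (t i ℤ.- t′ i)
          ≈⟨ +-identityˡ _ ⟩
        ι (t i ℤ.- t′ i) ∎)
      where
      module F  = Factorisation Fc
      module F′ = Factorisation Fc′
      codes = Finₚ.combine-injective (funToFin (trit ∘ x)) (inject≤ (F.residue (F.∈basis v∈)) det≤I) (funToFin (trit ∘ x′)) _ eq
      residues : F.residue (F.∈basis v∈) ≡ F′.residue (F′.∈basis v′∈)
      residues = Finₚ.inject≤-injective det≤I det≤I′ _ _ (proj₂ codes)
      t  = F.quotient (F.∈basis v∈)
      t′ = F′.quotient (F′.∈basis v′∈)
      fractional : (λ i → x i - ι (t i)) ≋ (λ i → x′ i - ι (t′ i))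
      fractional = ⊛-injective A λ i → trans (F.coordinates-residue (F.∈basis v∈) v≋ i)
        (trans (reflexive (cong (λ m → ι (lookup (digits A m) i)) residues))
          (sym (F′.coordinates-residue (F′.∈basis v′∈) v′≋ i)))

  ⟨⟩-additive : ∀ {n} (g x y : Vector R n) → ⟨ g , (λ i → x i + y i) ⟩ ≈ ⟨ g , x ⟩ + ⟨ g , y ⟩
  ⟨⟩-additive g x y = trans (sum-cong λ i → distribˡ (g i) (x i) (y i))
    (∑-distrib-+ (λ i → g i * x i) (λ i → g i * y i))

  ⟨⟩-scalar : ∀ {n} (g x : Vector R n) a → ⟨ g , (λ i → a * x i) ⟩ ≈ a * ⟨ g , x ⟩
  ⟨⟩-scalar g x a = trans
    (sum-cong λ i → solve 3 (λ g a x → g :* (a :* x) := a :* (g :* x)) refl (g i) a (x i))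
    (sym (*-distribˡ-sum a (λ i → g i * x i)))

  norm≈0⇒≈0 : ∀ {n} {v : Vector R n} → ⟨ v , v ⟩ ≈ 0# → v ≋ 𝟎
  norm≈0⇒≈0 {v = v} eq i = x²≈0⇒x≈0 (sum≈0⇒≈0 (λ i → v i * v i) (λ i → 0≤x² (v i)) eq i)

  bilinear-scale : ∀ {d} (M : Matrix d) s x y → bilinear (λ a b → s * M a b) x y ≈ s * bilinear M x y
  bilinear-scale M s x y = trans
    (sum-cong λ i → trans (sum-cong λ j → *-assoc s (M i j) (x i * y j)) (sym (*-distribˡ-sum s (λ j → M i j * (x i * y j)))))
    (sym (*-distribˡ-sum s (λ i → sum (λ j → M i j * (x i * y j)))))

  bilinear-minus : ∀ {d} (M N : Matrix d) x y → bilinear (λ a b → M a b - N a b) x y ≈ bilinear M x y - bilinear N x y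
  bilinear-minus M N x y = trans
    (sum-cong λ i → trans
      (sum-cong λ j → solve 3 (λ m n z → (m :- n) :* z := m :* z :- n :* z) refl (M i j) (N i j) (x i * y j))
      (sum-minus (λ j → M i j * (x i * y j)) (λ j → N i j * (x i * y j))))
    (sum-minus (λ i → sum (λ j → M i j * (x i * y j))) (λ i → sum (λ j → N i j * (x i * y j))))

  -- Reconstruction of a lattice up to similarity.

  gram : ∀ {d} → Vector (Vector R d) d → Matrix d
  gram b i j = ⟨ b i , b j ⟩

  hollow-detected : ∀ {d} {ω θ : Vector (Vector R (triangle d)) (triangle d)} → Dual ω θ →
    (M : Matrix d) → (∀ i j → M i j ≈ M j i) → (∀ i → M i i ≈ 0#) →
    (∀ p → ∃[ x ] (ω p ≋ upper d (outer x x) × bilinear M x x ≈ 0#)) → ∀ i j → M i j ≈ 0#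
  hollow-detected {d} {ω} D M symm diag chosen i j = trans (sym (hollow-upper d M symm diag i j))
    (hollow≈0 d (Dual.separating D (upper d M) vanish) i j)
    where
    vanish : ∀ p → ⟨ upper d M , ω p ⟩ ≈ 0#
    vanish p with x , ω≋ , M⊥ ← chosen p = trans (⟨⟩-congʳ (upper d M) ω≋) (x+x≈0⇒x≈0 (begin
      ⟨ upper d M , upper d (outer x x) ⟩ + ⟨ upper d M , upper d (outer x x) ⟩  ≈⟨ sym (bilinear-hollow d (upper d M) x) ⟩
      bilinear (hollow d (upper d M)) x x                                     ≈⟨ bilinear-cong x x (hollow-upper d M symm diag) ⟩
      bilinear M x x                                                          ≈⟨ M⊥ ⟩
      0#                                                                      ∎))

  module Similarity {d} {Λ Λ′ : Lattice (suc d)} (F : Frame Λ) (F′ : Frame Λ′) {A : Triangular (suc d)}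
    (Fc : Factorisation Λ (Frame.vectors F) A) (Fc′ : Factorisation Λ′ (Frame.vectors F′) A)
    {ω θ : Vector (Vector R (triangle (suc d))) (triangle (suc d))} (D : Dual ω θ)
    (chosen : ∀ p → ∃[ v ] ∃[ v′ ] (Minimal Λ v × Minimal Λ′ v′ ×
      ω p ≋ upper (suc d) (outer (Frame.coordinate F v) (Frame.coordinate F v)) ×
      Frame.coordinate F v ≋ Frame.coordinate F′ v′)) where

    private
      module F   = Frame F
      module F′  = Frame F′
      module Fc  = Factorisation Fc
      module Fc′ = Factorisation Fc′
      b = F.vectors
      b′ = F′.vectors
      μ  = ⟨ b zero , b zero ⟩
      μ′ = ⟨ b′ zero , b′ zero ⟩
      μ≉0 : ¬ (μ ≈ 0#)
      μ≉0 eq = proj₁ (proj₂ (F.minimal zero)) (norm≈0⇒≈0 eq)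
      μ′≉0 : ¬ (μ′ ≈ 0#)
      μ′≉0 eq = proj₁ (proj₂ (F′.minimal zero)) (norm≈0⇒≈0 eq)
      z : R
      z = proj₁ (inverse μ μ≉0)
      μz≈1 : μ * z ≈ 1#
      μz≈1 = proj₂ (inverse μ μ≉0)

      -- The difference of the Gram matrices, cross-multiplied by the minima instead of normalised.
      -- Its diagonal vanishes because all frame vectors are minimal, and its form vanishes at the
      -- coordinates of the chosen vectors because these are minimal in both lattices.
      M : Matrix (suc d)
      M i j = μ′ * gram b i j - μ * gram b′ i j

      norm-in-frame : ∀ {Λ : Lattice (suc d)} (F : Frame Λ) v →
        bilinear (gram (Frame.vectors F)) (Frame.coordinate F v) (Frame.coordinate F v) ≈ ⟨ v , v ⟩
      norm-in-frame F v = trans (sym (inner-combination (Frame.vectors F) (Frame.coordinate F v) (Frame.coordinate F v)))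
        (sym (⟨⟩-cong (Frame.expand F v) (Frame.expand F v)))

      M⊥ : ∀ {v v′} → Minimal Λ v → Minimal Λ′ v′ → F.coordinate v ≋ F′.coordinate v′ →
           bilinear M (F.coordinate v) (F.coordinate v) ≈ 0#
      M⊥ {v} {v′} v-min v′-min ξ≋ξ′ = begin
        bilinear M ξ ξ
          ≈⟨ bilinear-minus (λ i j → μ′ * gram b i j) (λ i j → μ * gram b′ i j) ξ ξ ⟩
        bilinear (λ i j → μ′ * gram b i j) ξ ξ - bilinear (λ i j → μ * gram b′ i j) ξ ξ
          ≈⟨ +-cong (bilinear-scale (gram b) μ′ ξ ξ) (-‿cong (bilinear-scale (gram b′) μ ξ ξ)) ⟩
        μ′ * bilinear (gram b) ξ ξ - μ * bilinear (gram b′) ξ ξ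
          ≈⟨ +-cong (*-congˡ (trans (norm-in-frame F v) (minimal-norms Λ v-min (F.minimal zero))))
               (-‿cong (*-congˡ (trans (bilinear-vectors-cong (gram b′) ξ≋ξ′ ξ≋ξ′)
                 (trans (norm-in-frame F′ v′) (minimal-norms Λ′ v′-min (F′.minimal zero)))))) ⟩
        μ′ * μ - μ * μ′
          ≈⟨ x≈y⇒x-y≈0 (*-comm μ′ μ) ⟩
        0# ∎
        where ξ = F.coordinate v

      M≈0 : ∀ i j → M i j ≈ 0#
      M≈0 = hollow-detected D M
        (λ i j → +-cong (*-congˡ (⟨⟩-comm (b i) (b j))) (-‿cong (*-congˡ (⟨⟩-comm (b′ i) (b′ j)))))
        (λ i → trans (+-cong (*-congˡ (minimal-norms Λ (F.minimal i) (F.minimal zero)))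
                 (-‿cong (*-congˡ (minimal-norms Λ′ (F′.minimal i) (F′.minimal zero)))))
               (x≈y⇒x-y≈0 (*-comm μ′ μ)))
        λ p → let v , v′ , v-min , v′-min , ω≋ , ξ≋ξ′ = chosen p in
          F.coordinate v , ω≋ , M⊥ v-min v′-min ξ≋ξ′

      s : R
      s = μ′ * z

      gram-scale : ∀ i j → gram b′ i j ≈ s * gram b i j
      gram-scale i j = *-cancelˡ μ≉0 (begin
        μ * gram b′ i j              ≈⟨ x-y≈0⇒x≈y (M≈0 i j) ⟨
        μ′ * gram b i j              ≈⟨ trans (sym (*-identityʳ _)) (*-congˡ (sym μz≈1)) ⟩
        μ′ * gram b i j * (μ * z)    ≈⟨ solve 4 (λ n g m z → n :* g :* (m :* z) := m :* (n :* z :* g)) refl μ′ (gram b i j) μ z ⟩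
        μ * (s * gram b i j)         ∎)

      φ : Vector R (suc d) → Vector R (suc d)
      φ x = combination (F.coordinate x) b′

      -- The map `φ` sends the frame `b` to `b′`. Both frames arise from their Hermite bases by the
      -- same `A`, so it also sends one Hermite basis to the other, and hence `Λ` onto `Λ′`.
      φ-combination : ∀ {v} y → v ≋ combination y Fc.basis → φ v ≋ combination y Fc′.basis
      φ-combination {v} y v≋ t with x , Ax≋y ← ⊛-surjective A y = begin
        combination (F.coordinate v) b′ t      ≈⟨ combination-cong b′ (λ a → trans (⟨⟩-congʳ (F.duals a) v≋x) (F.coordinates x a)) t ⟩
        combination x b′ t                     ≈⟨ Fc′.change x t ⟩
        combination (A ⊛ x) Fc′.basis t        ≈⟨ combination-cong Fc′.basis Ax≋y t ⟩
        combination y Fc′.basis t              ∎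
        where
        v≋x : v ≋ combination x b
        v≋x t = trans (v≋ t) (trans (combination-cong Fc.basis (λ i → sym (Ax≋y i)) t) (sym (Fc.change x t)))

    similar : Similar Λ Λ′
    similar = record
      { map          = φ
      ; map-cong     = λ x y x≋y → combination-cong b′ λ a → ⟨⟩-congʳ (F.duals a) x≋y
      ; map-additive = λ x y t → trans (combination-cong b′ (λ a → ⟨⟩-additive (F.duals a) x y) t)
          (trans (sum-cong λ a → distribʳ (b′ a t) (F.coordinate x a) (F.coordinate y a))
            (∑-distrib-+ (λ a → F.coordinate x a * b′ a t) (λ a → F.coordinate y a * b′ a t)))
      ; map-scalar   = λ c x t → trans (combination-cong b′ (λ a → ⟨⟩-scalar (F.duals a) x c) t)
          (trans (sum-cong λ a → *-assoc c (F.coordinate x a) (b′ a t))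
            (sym (*-distribˡ-sum c (λ a → F.coordinate x a * b′ a t))))
      ; scale        = s
      ; 0≤scale      = *-nonNegative (sum-nonNegative (λ i → b′ zero i * b′ zero i) (λ i → 0≤x² (b′ zero i)))
          -- The inverse `z` of `μ` is non-negative because it equals `μ * (z * z)`.
          (≤-respʳ (trans (sym (*-assoc μ z z)) (trans (*-congʳ μz≈1) (*-identityˡ z)))
            (*-nonNegative (sum-nonNegative (λ i → b zero i * b zero i) (λ i → 0≤x² (b zero i))) (0≤x² z)))
      ; scale≉0      = λ s≈0 → 0≉1 (trans (sym (zeroʳ μ)) (trans (*-congˡ (sym (*-cancelˡ-0 μ′≉0 s≈0))) μz≈1))
      ; map-inner    = λ x y → begin
          ⟨ φ x , φ y ⟩                                                        ≈⟨ inner-combination b′ (F.coordinate x) (F.coordinate y) ⟩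
          bilinear (gram b′) (F.coordinate x) (F.coordinate y)                 ≈⟨ bilinear-cong (F.coordinate x) (F.coordinate y) gram-scale ⟩
          bilinear (λ i j → s * gram b i j) (F.coordinate x) (F.coordinate y)  ≈⟨ bilinear-scale (gram b) s (F.coordinate x) (F.coordinate y) ⟩
          s * bilinear (gram b) (F.coordinate x) (F.coordinate y)              ≈⟨ *-congˡ (sym (trans (⟨⟩-cong (F.expand x) (F.expand y))
            (inner-combination b (F.coordinate x) (F.coordinate y)))) ⟩
          s * ⟨ x , y ⟩                                                        ∎
      ; into         = λ v v∈ → let c , v≋ = Fc.∈basis v∈ in
          span⇒∈ Λ′ (span-⊆ (proj₁ Fc′.same) (c , φ-combination (λ i → ι (c i)) v≋))
      ; onto         = λ w w∈ → let c , w≋ = Fc′.∈basis w∈ in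
          combination (λ i → ι (c i)) Fc.basis ,
          span⇒∈ Λ (span-⊆ (proj₁ Fc.same) (c , λ t → refl)) ,
          λ t → trans (φ-combination (λ i → ι (c i)) (λ t → refl) t) (sym (w≋ t))
      }

  -- The code of a perfect lattice and the final count.

  module _ {d I} (bounds : BoundsIndices (suc d) I) where

    record Presentation (Λ : Lattice (suc d)) : Set where
      field
        frame         : Frame Λ
        extremal      : Extremal frame
        {A}           : Triangular (suc d)
        reduced       : Reduced A
        factorisation : Factorisation Λ (Frame.vectors frame) A
        {ω θ}         : Vector (Vector R (triangle (suc d))) (triangle (suc d))
        isDual        : Dual ω θ
        offDiagonal   : ∀ p → OffDiagonal Λ (Frame.duals frame) (ω p)

      open Frame frame public using (coordinate; expand)

      det≤I : det A ℕ.≤ I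
      det≤I = index-bound bounds Λ frame
        (box-family Λ A (Factorisation.same factorisation) (Factorisation.factors factorisation) (Factorisation.independent factorisation))

      chosen : Fin (triangle (suc d)) → Vector R (suc d)
      chosen p = proj₁ (offDiagonal p)

      chosen-minimal : ∀ p → Minimal Λ (chosen p)
      chosen-minimal p = proj₁ (proj₂ (offDiagonal p))

      chosenCode : Fin (triangle (suc d)) → Fin (3 ℕ.^ suc d ℕ.* I)
      chosenCode p = vectorCode factorisation det≤I (proj₁ (chosen-minimal p)) (coordinate (chosen p))

      -- The suc d rows need suc d digits only; the digit 0 is a spare one.
      hermiteCode : Fin (suc (suc d)) → Fin I
      hermiteCode zero    = code reduced det≤I zero
      hermiteCode (suc i) = code reduced det≤I i

    open Presentation

    chosenCode-injective : ∀ {Λ Λ′} (P : Presentation Λ) (P′ : Presentation Λ′) → A P ≡ A P′ → ∀ p p′ →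
      chosenCode P p ≡ chosenCode P′ p′ → coordinate P (chosen P p) ≋ coordinate P′ (chosen P′ p′)
    chosenCode-injective P P′ A≡A′ p p′ = vectorCode-injective A≡A′ (factorisation P) (factorisation P′)
      (det≤I P) (det≤I P′) (proj₁ (chosen-minimal P p)) (proj₁ (chosen-minimal P′ p′)) (expand P (chosen P p)) (expand P′ (chosen P′ p′))
      (extremal P _ (chosen-minimal P p)) (extremal P′ _ (chosen-minimal P′ p′))

    -- Equal codes force equal coordinates and so equal vectors `ω p`, which are distinct as members
    -- of a basis. Hence the codes form a subset with exactly `triangle (suc d)` elements.
    chosenSubset : ∀ {Λ} (P : Presentation Λ) → Σ[ s ∈ Combination (3 ℕ.^ suc d ℕ.* I) (triangle (suc d)) ] Image (chosenCode P) s
    chosenSubset P = image (chosenCode P) λ {p} {p′} eq → Dual.injective (isDual P) p p′ λ q →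
      let ξ≋ = chosenCode-injective P P ≡.refl p p′ eq in
      trans (proj₂ (proj₂ (offDiagonal P p)) q)
        (trans (upper-cong (suc d) (λ i j → *-cong (ξ≋ i) (ξ≋ j)) q) (sym (proj₂ (proj₂ (offDiagonal P p′)) q)))

    latticeCode : ∀ {Λ} → Presentation Λ → Fin (I ℕ.^ suc (suc d) ℕ.* pascal (3 ℕ.^ suc d ℕ.* I) (triangle (suc d)))
    latticeCode P = combine (funToFin (hermiteCode P)) (rank (proj₁ (chosenSubset P)))

    -- The matrix of the second lattice is a variable here, so that the equality can be matched with
    -- `refl`; for two presentations both sides would be projections.
    similar-from-factorisations : ∀ {Λ Λ′} (P : Presentation Λ) (F′ : Frame Λ′) {A′} → A P ≡ A′ →
      Factorisation Λ′ (Frame.vectors F′) A′ →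
      (∀ p → ∃[ v′ ] (Minimal Λ′ v′ × coordinate P (chosen P p) ≋ Frame.coordinate F′ v′)) → Similar Λ Λ′
    similar-from-factorisations P F′ ≡.refl Fc′ same = Similarity.similar (frame P) F′ (factorisation P) Fc′ (isDual P)
      λ p → chosen P p , proj₁ (same p) , chosen-minimal P p , proj₁ (proj₂ (same p)) ,
        proj₂ (proj₂ (offDiagonal P p)) , proj₂ (proj₂ (same p))

    latticeCode-injective : ∀ {Λ Λ′} (P : Presentation Λ) (P′ : Presentation Λ′) →
                            latticeCode P ≡ latticeCode P′ → Similar Λ Λ′
    latticeCode-injective {Λ} {Λ′} P P′ eq = similar-from-factorisations P (frame P′) A≡A′ (factorisation P′) same
      where
      codes = Finₚ.combine-injective (funToFin (hermiteCode P)) (rank (proj₁ (chosenSubset P)))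
        (funToFin (hermiteCode P′)) (rank (proj₁ (chosenSubset P′))) eq
      A≡A′ : A P ≡ A P′
      A≡A′ = code-injective (reduced P) (reduced P′) (det≤I P) (det≤I P′)
        (funToFin-injective (hermiteCode P) (hermiteCode P′) (proj₁ codes) ∘ suc)
      subsets : proj₁ (chosenSubset P) ≡ proj₁ (chosenSubset P′)
      subsets = rank-injective (proj₁ (chosenSubset P)) (proj₁ (chosenSubset P′)) (proj₂ codes)
      -- A subset forgets the order of the chosen vectors, so `p` is matched with whichever `p′` has
      -- the same code. The basis `ω` of the first presentation then serves for both lattices.
      same : ∀ p → ∃[ v′ ] (Minimal Λ′ v′ × coordinate P (chosen P p) ≋ coordinate P′ v′)
      same p =
        let p′ , eq′ = proj₂ (proj₂ (chosenSubset P′)) (chosenCode P p)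
              (≡.subst (chosenCode P p ∈ᶜ_) subsets (proj₁ (proj₂ (chosenSubset P)) p))
        in chosen P′ p′ , chosen-minimal P′ p′ , chosenCode-injective P P′ A≡A′ p p′ (≡.sym eq′)

    presentation : ∀ {Λ} → Perfect Λ → ¬ ¬ Presentation Λ
    presentation {Λ} perfect k = extremal-frame bounds Λ perfect λ (F , ext) →
      separating⇒dual (offDiagonal-separating {Λ = Λ} perfect (Frame.isDual F)) λ (ω , θ , D , off) →
        let H = hermite (Lattice.basis Λ) (Frame.vectors F) (Frame.vectors∈ F) (Frame.vectors-independent F) in
        k (record
          { frame = F ; extremal = ext ; reduced = Hermite.reduced H
          ; factorisation = record { same = Hermite.same H ; factors = Hermite.factors H ; independent = Frame.vectors-independent F }
          ; isDual = D ; offDiagonal = off })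

    perfect-classes : ClassesAtMost (Perfect {suc d}) Similar
      (I ℕ.^ suc (suc d) ℕ.* pascal (3 ℕ.^ suc d ℕ.* I) (triangle (suc d)))
    perfect-classes m f perfect distinct = decidable-stable (m ℕ.≤? _) λ m≰ →
      ¬¬-Fin m (λ i → presentation (perfect i)) λ P →
        m≰ (Finₚ.injective⇒≤ λ {i} {j} eq → distinct i j (latticeCode-injective (P i) (P j) eq))

open import Data.Nat using (_≤_; _*_; _^_)

theorem10p1 : (ℝ : CompleteOrderedField) →
    let open EuclideanLattices ℝ in
    (d : ℕ) → 2 ≤ d →
    (I : ℕ) → IsMaximalIndex d I →
    ClassesAtMost (Perfect {d}) Similar
    (I ^ suc d * ((3 ^ d * I) C (d C 2)))
theorem10p1 ℝ (suc d) 2≤d I (bounds , _) = ≡.subst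
  (λ n → ClassesAtMost (Perfect {suc d}) Similar (I ^ suc (suc d) * n))
  (≡.trans (pascal≡C (3 ^ suc d * I) (triangle (suc d))) (cong ((3 ^ suc d * I) C_) (triangle≡C2 (suc d))))
  (Counting.perfect-classes ℝ bounds)
  where open EuclideanLattices ℝ
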